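{- There exists an absolute constant $C>0$ such that for all integers $n,t,k\geq 2$, the number of antichains of $[t]^n$ of size at most $\frac{1}{k}\cdot \alpha(t,n)$ is at most $$\exp_2\left(C\cdot\frac{\log k}{k}\cdot \alpha(t,n)\right).$$
   Context: For an integer $t\geq 2$ write $[t]=\{0,1,\dots,t-1\}$. The hypergrid $[t]^n$ is the poset on $[t]^n$ with the coordinate-wise order: $x\preceq y$ iff $x(i)\leq y(i)$ for all $i$. $\alpha(t,n)$ denotes the maximum size of an antichain in $[t]^n$. $\exp_2(x)=2^x$. -}

module Defs where

open import Data.Nat using (ℕ; zero; suc; _⊔_)
open import Data.Fin using (Fin)
import Data.Fin.Properties as FinP
open import Data.Fin using () renaming (_≤_ to _≤ᶠ_)
open import Data.Vec using (Vec; []; _∷_)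
open import Data.Vec.Relation.Binary.Pointwise.Inductive using (Pointwise)
import Data.Vec.Relation.Binary.Pointwise.Inductive as PW
open import Data.List using (List; []; _∷_; [_]; map; concatMap; _++_; length; filter; allFin; foldr)
open import Data.List.Relation.Unary.AllPairs using (AllPairs; allPairs?)
open import Data.Product using (_×_)
open import Relation.Nullary using (¬_; Dec)
open import Relation.Nullary.Decidable using (¬?; _×-dec_)

Point : ℕ → ℕ → Set
Point t n = Vec (Fin t) n

_≼_ : ∀ {t n} → Point t n → Point t n → Set
x ≼ y = Pointwise _≤ᶠ_ x y

_≼?_ : ∀ {t n} (x y : Point t n) → Dec (x ≼ y)
x ≼? y = PW.decidable FinP._≤?_ x y

Incomparable : ∀ {t n} → Point t n → Point t n → Set
Incomparable x y = ¬ (x ≼ y) × ¬ (y ≼ x)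

incomparable? : ∀ {t n} (x y : Point t n) → Dec (Incomparable x y)
incomparable? x y = ¬? (x ≼? y) ×-dec ¬? (y ≼? x)

-- A finite set of points (given as a list of distinct points) is an antichain
-- iff any two of its (distinct) members are incomparable.
IsAntichain : ∀ {t n} → List (Point t n) → Set
IsAntichain = AllPairs Incomparable

isAntichain? : ∀ {t n} (A : List (Point t n)) → Dec (IsAntichain A)
isAntichain? = allPairs? incomparable?

allPoints : (t n : ℕ) → List (Point t n)
allPoints t zero = [ [] ]
allPoints t (suc n) = concatMap (λ i → map (i ∷_) (allPoints t n)) (allFin t)

-- All sublists of a list; for a duplicate-free list these correspond
-- bijectively to its subsets.
sublists : ∀ {a} {A : Set a} → List A → List (List A)
sublists [] = [ [] ]
sublists (x ∷ xs) = let s = sublists xs in map (x ∷_) s ++ s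

allSubsets : (t n : ℕ) → List (List (Point t n))
allSubsets t n = sublists (allPoints t n)

antichains : (t n : ℕ) → List (List (Point t n))
antichains t n = filter isAntichain? (allSubsets t n)

α : ℕ → ℕ → ℕ
α t n = foldr _⊔_ 0 (map length (antichains t n))

numSmallAntichains : (t n k : ℕ) → ℕ
numSmallAntichains t n k =
  length (filter (λ A → Data.Nat._≤?_ (k Data.Nat.* length A) (α t n)) (antichains t n))
  where import Data.Nat

{-# OPTIONS --safe #-}
-- Write u(x) for the number of points of a set Y lying above x ∈ Y. The points of Y with a given value of u form an
-- antichain, so at most ρ·α of them have u(x) < ρ. Applying this in both factors of [t]^n = [t]^a × [t]^b, a set of more
-- than ρ (α(t,a) t^b + α(t,b) t^a) points contains a point with at least ρ² points of the set above it.
--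
-- For a = ⌊n/2⌋ and b = ⌈n/2⌉ the parenthesis is at most 32·α(t,n): symmetric chains give α(t,a) = the middle level of
-- [t]^a, and the level sizes are log-concave, so a constant proportion of [t]^a lies in levels of at least half that size;
-- pairing points of equal rank then gives a large level of [t]^2a.
--
-- Finally, N(X,m), the number of antichains of size at most m inside X, satisfies
-- N(X,m) ≤ N(X∖v,m) + N(X∖{comparable to v},m−1). Choosing v with ≥ ρ² points above it as long as |X| ≥ 33αρ gives
-- N(X,m) ≤ q^m ∏_{x ≤ |X|} (1 + 1/D(x)), where q = k^36 and D(x) is about (x/α)^(3/2) beyond the first scale.
module Submission where

open import Defs
open import Data.Fin using (Fin; zero; suc; toℕ; fromℕ<; opposite)
import Data.Fin.Properties as FinP
open import Data.List using (List; []; _∷_; map; _++_; concatMap; length; filter; upTo; allFin; foldr)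
open import Data.List.Properties using (map-upTo; map-tabulate; length-tabulate; length-upTo; length-filter; filter-accept; filter-reject)
import Data.List.Membership.DecPropositional as DecMembership
open import Data.List.Membership.Propositional using (_∈_; _∉_)
open import Data.List.Membership.Propositional.Properties using (∈-upTo⁺; ∈-upTo⁻; ∈-concat⁺′; ∈-map⁺; ∈-map⁻; ∈-allFin; ∈-++⁺ˡ; ∈-++⁺ʳ; ∈-filter⁺; ∈-filter⁻; ∈-∃++)
open import Data.List.Relation.Binary.Disjoint.Propositional using (Disjoint)
open import Data.List.Relation.Binary.Permutation.Propositional using (_↭_; prep; swap; ↭-sym; ↭⇒↭ₛ)
import Data.List.Relation.Binary.Permutation.Propositional as P
import Data.List.Relation.Binary.Permutation.Propositional.Properties as Perm
import Data.List.Relation.Binary.Permutation.Setoid.Properties as SetoidPerm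
open import Data.List.Relation.Unary.All using (All; []; _∷_)
import Data.List.Relation.Unary.All as All
import Data.List.Relation.Unary.All.Properties as AllP
open import Data.List.Relation.Unary.AllPairs using (AllPairs; []; _∷_)
import Data.List.Relation.Unary.AllPairs as AllPairs
import Data.List.Relation.Unary.AllPairs.Properties as AllPairsP
open import Data.List.Relation.Unary.Any using (here; there)
open import Data.List.Relation.Unary.Unique.Propositional using (Unique)
import Data.List.Relation.Unary.Unique.Propositional.Properties as UniqueP
open import Data.Nat using (ℕ; zero; suc; _+_; _*_; _∸_; _⊓_; _⊔_; _^_; _≤_; _<_; _≥_; z≤n; s≤s; NonZero; >-nonZero; ⌊_/2⌋; ⌈_/2⌉)
open import Data.Nat.DivMod using (_/_; m*n/n≡m; /-monoˡ-≤; m/n*n≤m)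
open import Data.Nat.Properties
open import Data.Nat.Tactic.RingSolver using (solve-∀)
open import Data.Product using (Σ; ∃; _×_; _,_; proj₁; proj₂)
open import Data.Sum using (_⊎_; inj₁; inj₂; [_,_]′)
open import Data.Vec using ([]; _∷_; replicate) renaming (_++_ to _++ᵛ_; map to mapᵛ)
import Data.Vec.Properties as VecP
open import Data.Vec.Relation.Binary.Pointwise.Inductive using ([]; _∷_)
import Data.Vec.Relation.Binary.Pointwise.Inductive as PW
open import Function using (_∘_)
open import Relation.Binary using (DecidableEquality)
open import Relation.Binary.PropositionalEquality using (_≡_; _≢_; refl; sym; trans; cong; cong₂; subst; subst₂; module ≡-Reasoning)
open import Relation.Binary.PropositionalEquality.Properties using (setoid)
open import Relation.Nullary using (¬_; Dec; yes; no; contradiction)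
open import Relation.Nullary.Decidable using (_×-dec_)
open import Relation.Unary using (Decidable)

-- The gain of ρ², rather than ρ, is what makes the count work. If a chosen vertex of a set of size
-- about ρα removed only ρ points, shrinking the set by a constant factor would take order α
-- choices, more than the α / k available. With ρ² it takes order α / ρ, and these costs decay
-- geometrically over the scales. This is why the grid is cut into two factors, each supplying one
-- factor ρ.
--
-- The exponent 3/2 of D lies strictly between two constraints: below 2, so that the ρ² deleted
-- points change the product by more than a factor D; above 1, so that the sum of 1 / D(x)
-- converges. Only choices made at the first scale have to be paid for by q.
--
-- Logarithms and reals are replaced by integer powers: products of 1 + 1/r are kept as fractions,
-- inequalities are compared after raising them to a common power, and (1 + 1/r)^r ≤ 4 plays the
-- role of the exponential.

private variable
  S S′ : Set
  P Q : Set
  t n : ℕ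

-- Indicators and finite sums

𝟙 : Dec P → ℕ
𝟙 (yes _) = 1
𝟙 (no _)  = 0

𝟙-true : (d : Dec P) → P → 𝟙 d ≡ 1
𝟙-true (yes _) _ = refl
𝟙-true (no ¬p) p = contradiction p ¬p

𝟙-false : (d : Dec P) → ¬ P → 𝟙 d ≡ 0
𝟙-false (yes p) ¬p = contradiction p ¬p
𝟙-false (no _)  _  = refl

𝟙≤1 : (d : Dec P) → 𝟙 d ≤ 1
𝟙≤1 (yes _) = ≤-refl
𝟙≤1 (no _)  = z≤n

𝟙-elim : (d : Dec P) {m : ℕ} → (P → 1 ≤ m) → 𝟙 d ≤ m
𝟙-elim (yes p) f = f p
𝟙-elim (no _)  _ = z≤n

𝟙-mono : (d : Dec P) (e : Dec Q) → (P → Q) → 𝟙 d ≤ 𝟙 e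
𝟙-mono d e f = 𝟙-elim d λ p → ≤-reflexive (sym (𝟙-true e (f p)))

𝟙-cong : (d : Dec P) (e : Dec Q) → (P → Q) → (Q → P) → 𝟙 d ≡ 𝟙 e
𝟙-cong d e f g = ≤-antisym (𝟙-mono d e f) (𝟙-mono e d g)

𝟙-positive : (d : Dec P) → 0 < 𝟙 d → P
𝟙-positive (yes p) _ = p

𝟙-disjoint : (d : Dec P) (e : Dec Q) → (P → ¬ Q) → 𝟙 d + 𝟙 e ≤ 1
𝟙-disjoint (no _)  e h = 𝟙≤1 e
𝟙-disjoint (yes p) e h = ≤-reflexive (cong suc (𝟙-false e (h p)))

𝟙-*-mono : (d : Dec P) {m n : ℕ} → (P → m ≤ n) → 𝟙 d * m ≤ 𝟙 d * n
𝟙-*-mono (yes p) f = *-monoʳ-≤ 1 (f p)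
𝟙-*-mono (no _)  _ = z≤n

+-interchange : ∀ a b c d → a + b + (c + d) ≡ a + c + (b + d)
+-interchange = solve-∀

∑ : List S → (S → ℕ) → ℕ
∑ []       f = 0
∑ (x ∷ xs) f = f x + ∑ xs f

∑-mono-∈ : (xs : List S) {f g : S → ℕ} → (∀ {x} → x ∈ xs → f x ≤ g x) → ∑ xs f ≤ ∑ xs g
∑-mono-∈ []       h = z≤n
∑-mono-∈ (x ∷ xs) h = +-mono-≤ (h (here refl)) (∑-mono-∈ xs (h ∘ there))

∑-mono : (xs : List S) {f g : S → ℕ} → (∀ x → f x ≤ g x) → ∑ xs f ≤ ∑ xs g
∑-mono xs h = ∑-mono-∈ xs λ {x} _ → h x

∑-cong : (xs : List S) {f g : S → ℕ} → (∀ x → f x ≡ g x) → ∑ xs f ≡ ∑ xs g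
∑-cong []       h = refl
∑-cong (x ∷ xs) h = cong₂ _+_ (h x) (∑-cong xs h)

∑-+ : (xs : List S) (f g : S → ℕ) → ∑ xs (λ x → f x + g x) ≡ ∑ xs f + ∑ xs g
∑-+ []       f g = refl
∑-+ (x ∷ xs) f g = trans (cong (f x + g x +_) (∑-+ xs f g)) (+-interchange (f x) (g x) (∑ xs f) (∑ xs g))

∑-*ˡ : (c : ℕ) (xs : List S) (f : S → ℕ) → ∑ xs (λ x → c * f x) ≡ c * ∑ xs f
∑-*ˡ c []       f = sym (*-zeroʳ c)
∑-*ˡ c (x ∷ xs) f = trans (cong (c * f x +_) (∑-*ˡ c xs f)) (sym (*-distribˡ-+ c (f x) (∑ xs f)))

∑-*ʳ : (c : ℕ) (xs : List S) (f : S → ℕ) → ∑ xs (λ x → f x * c) ≡ ∑ xs f * c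
∑-*ʳ c []       f = refl
∑-*ʳ c (x ∷ xs) f = trans (cong (f x * c +_) (∑-*ʳ c xs f)) (sym (*-distribʳ-+ c (f x) (∑ xs f)))

∑-const : (xs : List S) (c : ℕ) → ∑ xs (λ _ → c) ≡ length xs * c
∑-const []       c = refl
∑-const (x ∷ xs) c = cong (c +_) (∑-const xs c)

∑-zero : (xs : List S) → ∑ xs (λ _ → 0) ≡ 0
∑-zero xs = trans (∑-const xs 0) (*-zeroʳ (length xs))

∑-++ : (xs ys : List S) (f : S → ℕ) → ∑ (xs ++ ys) f ≡ ∑ xs f + ∑ ys f
∑-++ []       ys f = refl
∑-++ (x ∷ xs) ys f = trans (cong (f x +_) (∑-++ xs ys f)) (sym (+-assoc (f x) (∑ xs f) (∑ ys f)))

∑-map : (g : S′ → S) (xs : List S′) (f : S → ℕ) → ∑ (map g xs) f ≡ ∑ xs (f ∘ g)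
∑-map g []       f = refl
∑-map g (x ∷ xs) f = cong (f (g x) +_) (∑-map g xs f)

∑-concatMap : (g : S′ → List S) (xs : List S′) (f : S → ℕ) →
              ∑ (concatMap g xs) f ≡ ∑ xs (λ x → ∑ (g x) f)
∑-concatMap g []       f = refl
∑-concatMap g (x ∷ xs) f =
  trans (∑-++ (g x) (concatMap g xs) f) (cong (∑ (g x) f +_) (∑-concatMap g xs f))

∑-swap : (xs : List S) (ys : List S′) (f : S → S′ → ℕ) →
         ∑ xs (λ x → ∑ ys (f x)) ≡ ∑ ys (λ y → ∑ xs (λ x → f x y))
∑-swap []       ys f = sym (∑-zero ys)
∑-swap (x ∷ xs) ys f = trans (cong (∑ ys (f x) +_) (∑-swap xs ys f))
  (sym (∑-+ ys (f x) (λ y → ∑ xs (λ x → f x y))))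

∑-positive : (xs : List S) (f : S → ℕ) → 0 < ∑ xs f → ∃ λ x → x ∈ xs × 0 < f x
∑-positive (x ∷ xs) f h with f x in eq
... | suc _ = x , here refl , subst (0 <_) (sym eq) (s≤s z≤n)
... | zero  = let y , y∈xs , h′ = ∑-positive xs f h in y , there y∈xs , h′

∑-member : {xs : List S} {x : S} (f : S → ℕ) → x ∈ xs → f x ≤ ∑ xs f
∑-member f (here refl) = m≤m+n _ _
∑-member {xs = y ∷ xs} f (there x∈xs) = ≤-trans (∑-member f x∈xs) (m≤n+m _ (f y))

length-filter-∑ : {R : S → Set} (R? : Decidable R) (xs : List S) → length (filter R? xs) ≡ ∑ xs (λ x → 𝟙 (R? x))
length-filter-∑ R? [] = refl
length-filter-∑ R? (x ∷ xs) with R? x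
... | yes _ = cong suc (length-filter-∑ R? xs)
... | no _  = length-filter-∑ R? xs

∑< : ℕ → (ℕ → ℕ) → ℕ
∑< n = ∑ (upTo n)

∑<-suc : (n : ℕ) (f : ℕ → ℕ) → ∑< (suc n) f ≡ f 0 + ∑< n (f ∘ suc)
∑<-suc n f = cong (f 0 +_)
  (trans (cong (λ xs → ∑ xs f) (sym (map-upTo suc n))) (∑-map suc (upTo n) f))

∑<-+ : (m n : ℕ) (f : ℕ → ℕ) → ∑< (m + n) f ≡ ∑< m f + ∑< n (λ j → f (m + j))
∑<-+ zero    n f = refl
∑<-+ (suc m) n f = trans (∑<-suc (m + n) f) (trans (cong (f 0 +_) (∑<-+ m n (f ∘ suc)))
  (trans (sym (+-assoc (f 0) (∑< m (f ∘ suc)) (∑< n (λ j → f (suc m + j)))))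
    (cong (_+ ∑< n (λ j → f (suc m + j))) (sym (∑<-suc m f)))))

∑<-mono-< : (n : ℕ) {f g : ℕ → ℕ} → (∀ {j} → j < n → f j ≤ g j) → ∑< n f ≤ ∑< n g
∑<-mono-< n h = ∑-mono-∈ (upTo n) (h ∘ ∈-upTo⁻)

∑<-cong-< : (n : ℕ) {f g : ℕ → ℕ} → (∀ {j} → j < n → f j ≡ g j) → ∑< n f ≡ ∑< n g
∑<-cong-< n h = ≤-antisym (∑<-mono-< n (≤-reflexive ∘ h)) (∑<-mono-< n (≤-reflexive ∘ sym ∘ h))

∑<-snoc : (n : ℕ) (f : ℕ → ℕ) → ∑< (suc n) f ≡ ∑< n f + f n
∑<-snoc n f = trans (cong (λ m → ∑< m f) (sym (+-comm n 1)))
  (trans (∑<-+ n 1 f) (cong (∑< n f +_) (trans (+-identityʳ _) (cong f (+-identityʳ n)))))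

∑<-length : (m n : ℕ) (f : ℕ → ℕ) → m ≤ n → ∑< m f ≤ ∑< n f
∑<-length m n f m≤n = subst (λ k → ∑< m f ≤ ∑< k f) (m+[n∸m]≡n m≤n)
  (≤-trans (m≤m+n _ _) (≤-reflexive (sym (∑<-+ m (n ∸ m) f))))

-- The contradiction between two hits is phrased as `1 ≤ 0` because `𝟙-elim` asks for exactly this
-- once a hit at 0 is fixed and all later terms have to be bounded by 0.
∑<-at-most-one : (n : ℕ) {R : ℕ → Set} (R? : ∀ j → Dec (R j)) →
                 (∀ {i j} → i < j → j < n → R i → R j → 1 ≤ 0) → ∑< n (λ j → 𝟙 (R? j)) ≤ 1
∑<-at-most-one zero    R? h = z≤n
∑<-at-most-one (suc n) R? h rewrite ∑<-suc n (λ j → 𝟙 (R? j)) with R? 0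
... | no _  = ∑<-at-most-one n (R? ∘ suc) λ i<j j<n → h (s≤s i<j) (s≤s j<n)
... | yes p = s≤s (≤-trans
  (∑<-mono-< n λ {j} j<n → 𝟙-elim (R? (suc j)) λ q → h (s≤s z≤n) (s≤s j<n) p q)
  (≤-reflexive (∑-zero (upTo n))))

module _ (_≟_ : DecidableEquality S) where

  open DecMembership _≟_ using (_∈?_)

  ∑-δ-∉ : (xs : List S) {a : S} (g : S → ℕ) → a ∉ xs → ∑ xs (λ x → 𝟙 (x ≟ a) * g x) ≡ 0
  ∑-δ-∉ []       g a∉ = refl
  ∑-δ-∉ (x ∷ xs) {a} g a∉ rewrite 𝟙-false (x ≟ a) (λ e → a∉ (here (sym e))) = ∑-δ-∉ xs g (a∉ ∘ there)

  ∑-δ : {xs : List S} {a : S} (g : S → ℕ) → Unique xs → a ∈ xs → ∑ xs (λ x → 𝟙 (x ≟ a) * g x) ≡ g a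
  ∑-δ {x ∷ xs} g u@(_ ∷ _) (here refl) rewrite 𝟙-true (x ≟ x) refl | ∑-δ-∉ xs g (UniqueP.Unique[x∷xs]⇒x∉xs u) =
    trans (+-identityʳ _) (+-identityʳ _)
  ∑-δ {x ∷ xs} {a} g (x∉ ∷ u) (there a∈) rewrite 𝟙-false (x ≟ a) (All.lookup x∉ a∈) = ∑-δ g u a∈

  -- Bridge between lists and predicates: a duplicate-free list becomes a membership weight on the
  -- ambient list.
  ∑-subset : {L : List S} (X : List S) (g : S → ℕ) → Unique L → Unique X → (∀ {x} → x ∈ X → x ∈ L) →
             ∑ L (λ x → 𝟙 (x ∈? X) * g x) ≡ ∑ X g
  ∑-subset {L} [] g uL uX X⊆L = ∑-zero L
  ∑-subset {L} (a ∷ X) g uL uX@(a≢X ∷ uX′) X⊆L = trans (∑-cong L split)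
    (trans (∑-+ L (λ x → 𝟙 (x ≟ a) * g x) (λ x → 𝟙 (x ∈? X) * g x))
      (cong₂ _+_ (∑-δ g uL (X⊆L (here refl))) (∑-subset X g uL uX′ (X⊆L ∘ there))))
    where
    indicator : ∀ x → 𝟙 (x ∈? (a ∷ X)) ≡ 𝟙 (x ≟ a) + 𝟙 (x ∈? X)
    indicator x with x ≟ a
    ... | yes refl = cong suc (sym (𝟙-false (x ∈? X) (UniqueP.Unique[x∷xs]⇒x∉xs uX)))
    ... | no x≢a   = 𝟙-cong _ (x ∈? X) (λ { (here e) → contradiction e x≢a ; (there m) → m }) there
    split : ∀ x → 𝟙 (x ∈? (a ∷ X)) * g x ≡ 𝟙 (x ≟ a) * g x + 𝟙 (x ∈? X) * g x
    split x = trans (cong (_* g x) (indicator x)) (*-distribʳ-+ (g x) (𝟙 (x ≟ a)) (𝟙 (x ∈? X)))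

-- Points of the hypergrid

≼-refl : {x : Point t n} → x ≼ x
≼-refl = PW.refl FinP.≤-refl

≼-trans : {x y z : Point t n} → x ≼ y → y ≼ z → x ≼ z
≼-trans = PW.trans FinP.≤-trans

≼-antisym : {x y : Point t n} → x ≼ y → y ≼ x → x ≡ y
≼-antisym []         []         = refl
≼-antisym (i≤j ∷ le) (j≤i ∷ ge) = cong₂ _∷_ (FinP.≤-antisym i≤j j≤i) (≼-antisym le ge)

_≟ᵖ_ : DecidableEquality (Point t n)
_≟ᵖ_ = VecP.≡-dec FinP._≟_

_∈ᵖ?_ : (x : Point t n) (X : List (Point t n)) → Dec (x ∈ X)
_∈ᵖ?_ = DecMembership._∈?_ _≟ᵖ_

∈-allPoints : (x : Point t n) → x ∈ allPoints t n
∈-allPoints []      = here refl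
∈-allPoints (i ∷ x) = ∈-concat⁺′ (∈-map⁺ (i ∷_) (∈-allPoints x)) (∈-map⁺ _ (∈-allFin i))

allPoints-unique : ∀ t n → Unique (allPoints t n)
allPoints-unique t zero    = [] ∷ []
allPoints-unique t (suc n) = UniqueP.concat⁺
  (AllP.map⁺ (All.universal (λ i → UniqueP.map⁺ VecP.∷-injectiveʳ (allPoints-unique t n)) (allFin t)))
  (AllPairsP.map⁺ (AllPairs.map disjoint (UniqueP.allFin⁺ t)))
  where
  disjoint : ∀ {i j} → i ≢ j → Disjoint (map (i ∷_) (allPoints t n)) (map (j ∷_) (allPoints t n))
  disjoint i≢j (p , q) =
    let _ , _ , e = ∈-map⁻ _ p ; _ , _ , e′ = ∈-map⁻ _ q
    in i≢j (VecP.∷-injectiveˡ (trans (sym e) e′))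

∑ᵖ : (Point t n → ℕ) → ℕ
∑ᵖ {t} {n} = ∑ (allPoints t n)

∑ᵖ-∷ : (f : Point t (suc n) → ℕ) → ∑ᵖ f ≡ ∑ (allFin t) (λ i → ∑ᵖ (λ x → f (i ∷ x)))
∑ᵖ-∷ {t} {n} f = trans (∑-concatMap (λ i → map (i ∷_) (allPoints t n)) (allFin t) f)
  (∑-cong (allFin t) λ i → ∑-map (i ∷_) (allPoints t n) f)

∑ᵖ-++ : ∀ m (f : Point t (m + n) → ℕ) → ∑ᵖ f ≡ ∑ᵖ {t} {m} (λ x → ∑ᵖ {t} {n} (λ y → f (x ++ᵛ y)))
∑ᵖ-++ zero    f = sym (+-identityʳ _)
∑ᵖ-++ {t} (suc m) f = trans (∑ᵖ-∷ f)
  (trans (∑-cong (allFin t) λ i → ∑ᵖ-++ m (λ x → f (i ∷ x))) (sym (∑ᵖ-∷ {t} {m} _)))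

∑-allFin : (t : ℕ) (f : ℕ → ℕ) → ∑ (allFin t) (f ∘ toℕ) ≡ ∑< t f
∑-allFin zero    f = refl
∑-allFin (suc t) f = trans (cong (f 0 +_)
  (trans (cong (λ xs → ∑ xs (f ∘ toℕ)) (sym (map-tabulate {n = t} (λ i → i) suc)))
    (trans (∑-map suc (allFin t) (f ∘ toℕ)) (∑-allFin t (f ∘ suc)))))
  (sym (∑<-suc t f))

∑ᵖ-const : (c : ℕ) → ∑ᵖ {t} {n} (λ _ → c) ≡ t ^ n * c
∑ᵖ-const {t} {zero}  c = refl
∑ᵖ-const {t} {suc n} c = trans (∑ᵖ-∷ {t} {n} (λ _ → c))
  (trans (∑-const (allFin t) _) (trans (cong₂ _*_ (length-tabulate {n = t} (λ i → i)) (∑ᵖ-const {t} {n} c))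
    (sym (*-assoc t (t ^ n) c))))

-- Expand f (σ x) as a sum over y supported at y = σ x and exchange the sums; y = σ x is the same as
-- x = σ y, so each y is met once.
∑ᵖ-involution : (σ : Point t n → Point t n) → (∀ x → σ (σ x) ≡ x) → (f : Point t n → ℕ) →
                ∑ᵖ (f ∘ σ) ≡ ∑ᵖ f
∑ᵖ-involution {t} {n} σ inv f = trans
  (∑-cong L λ x → sym (∑-δ _≟ᵖ_ f (allPoints-unique t n) (∈-allPoints (σ x))))
  (trans (∑-swap L L (λ x y → 𝟙 (y ≟ᵖ σ x) * f y))
    (∑-cong L λ y → trans
      (∑-cong L λ x → cong (_* f y) (𝟙-cong (y ≟ᵖ σ x) (x ≟ᵖ σ y)
        (λ e → trans (sym (inv x)) (cong σ (sym e)))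
        (λ e → trans (sym (inv y)) (cong σ (sym e)))))
      (∑-δ _≟ᵖ_ (λ _ → f y) (allPoints-unique t n) (∈-allPoints (σ y)))))
  where L = allPoints t n

-- Antichains as predicates and bounds on α

length≡∑ᵖ : {X : List (Point t n)} → Unique X → length X ≡ ∑ᵖ (λ x → 𝟙 (x ∈ᵖ? X))
length≡∑ᵖ {t} {n} {X} u = trans (sym (trans (∑-const X 1) (*-identityʳ _)))
  (trans (sym (∑-subset _≟ᵖ_ X (λ _ → 1) (allPoints-unique t n) u (λ {x} _ → ∈-allPoints x)))
    (∑-cong (allPoints t n) λ x → *-identityʳ _))

antichain⇒unique : {X : List (Point t n)} → IsAntichain X → Unique X
antichain⇒unique = AllPairs.map λ { (x⋠y , _) refl → x⋠y ≼-refl }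

filter∈sublists : {A : Set} {P : A → Set} (P? : Decidable P) (xs : List A) → filter P? xs ∈ sublists xs
filter∈sublists P? [] = here refl
filter∈sublists P? (x ∷ xs) with P? x
... | yes _ = ∈-++⁺ˡ (∈-map⁺ (x ∷_) (filter∈sublists P? xs))
... | no _  = ∈-++⁺ʳ (map (x ∷_) (sublists xs)) (filter∈sublists P? xs)

≤-maximum : {m : ℕ} {xs : List ℕ} → m ∈ xs → m ≤ foldr _⊔_ 0 xs
≤-maximum (here refl) = m≤m⊔n _ _
≤-maximum {xs = x ∷ _} (there m∈) = ≤-trans (≤-maximum m∈) (m≤n⊔m x _)

maximum-≤ : {m : ℕ} (xs : List ℕ) → (∀ {x} → x ∈ xs → x ≤ m) → foldr _⊔_ 0 xs ≤ m
maximum-≤ []       h = z≤n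
maximum-≤ (x ∷ xs) h = ⊔-lub (h (here refl)) (maximum-≤ xs (h ∘ there))

-- Filtering `allPoints` by P yields one of the sublists over which α is the maximum.
antichain-size≤α : {P : Point t n → Set} (P? : ∀ x → Dec (P x)) →
                   (∀ {x y} → P x → P y → x ≼ y → x ≡ y) → ∑ᵖ (λ x → 𝟙 (P? x)) ≤ α t n
antichain-size≤α {t} {n} {P} P? anti = ≤-trans (≤-reflexive (sym (length-filter-∑ P? (allPoints t n))))
  (≤-maximum (∈-map⁺ length (∈-filter⁺ isAntichain? (filter∈sublists P? (allPoints t n))
    (incomparable (UniqueP.filter⁺ P? (allPoints-unique t n)) (AllP.all-filter P? (allPoints t n))))))
  where
  incomparable : {X : List (Point t n)} → Unique X → All P X → IsAntichain X
  incomparable []       []       = []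
  incomparable (u ∷ us) (p ∷ ps) =
    All.zipWith (λ (x≢y , q) → (λ le → x≢y (anti p q le)) , (λ ge → x≢y (sym (anti q p ge)))) (u , ps)
    ∷ incomparable us ps

α≤ : {m : ℕ} → (∀ (A : List (Point t n)) → IsAntichain A → length A ≤ m) → α t n ≤ m
α≤ {t} {n} {m} h = maximum-≤ _ λ l∈ → let A , A∈ , e = ∈-map⁻ length l∈ in
  ≤-trans (≤-reflexive e) (h A (proj₂ (∈-filter⁻ isAntichain? {xs = allSubsets t n} A∈)))

antichain-length : {A : List (Point t n)} → IsAntichain A → length A ≡ ∑ᵖ (λ x → 𝟙 (x ∈ᵖ? A))
antichain-length = length≡∑ᵖ ∘ antichain⇒unique

antichain-∈ : {A : List (Point t n)} → IsAntichain A → ∀ {x y} → x ∈ A → y ∈ A → x ≼ y → x ≡ y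
antichain-∈ (_ ∷ _)  (here refl) (here refl) _  = refl
antichain-∈ (i ∷ _)  (here refl) (there y∈)  le = contradiction le (proj₁ (All.lookup i y∈))
antichain-∈ (i ∷ _)  (there x∈)  (here refl) le = contradiction le (proj₂ (All.lookup i x∈))
antichain-∈ (_ ∷ is) (there x∈)  (there y∈)  le = antichain-∈ is x∈ y∈ le

-- Fixing the first coordinate cuts an antichain into t slices, each an antichain in the other
-- coordinates.
α-suc≤ : ∀ t n → α t (suc n) ≤ t * α t n
α-suc≤ t n = α≤ λ A anti → begin
  length A                                                 ≡⟨ antichain-length anti ⟩
  ∑ᵖ (λ x → 𝟙 (x ∈ᵖ? A))                                   ≡⟨ ∑ᵖ-∷ {t} {n} _ ⟩
  ∑ (allFin t) (λ i → ∑ᵖ (λ x → 𝟙 ((i ∷ x) ∈ᵖ? A)))        ≤⟨ ∑-mono (allFin t) (λ i →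
      antichain-size≤α (λ x → (i ∷ x) ∈ᵖ? A) λ p q le → VecP.∷-injectiveʳ (antichain-∈ anti p q (FinP.≤-refl ∷ le))) ⟩
  ∑ (allFin t) (λ _ → α t n)                               ≡⟨ ∑-const (allFin t) _ ⟩
  length (allFin t) * α t n                                ≡⟨ cong (_* α t n) (length-tabulate {n = t} (λ i → i)) ⟩
  t * α t n                                                ∎
  where open ≤-Reasoning

-- Rank, complementation and levels

rank : Point t n → ℕ
rank []      = 0
rank (i ∷ x) = toℕ i + rank x

rank-mono : {x y : Point t n} → x ≼ y → rank x ≤ rank y
rank-mono []         = z≤n
rank-mono (i≤j ∷ le) = +-mono-≤ i≤j (rank-mono le)

rank-strict : {x y : Point t n} → x ≼ y → rank x ≡ rank y → x ≡ y
rank-strict [] _ = refl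
rank-strict {x = i ∷ x} {y = j ∷ y} (i≤j ∷ le) e = cong₂ _∷_ i≡j
  (rank-strict le (+-cancelˡ-≡ (toℕ i) _ _ (trans e (cong (λ k → toℕ k + rank y) (sym i≡j)))))
  where
  i≡j : i ≡ j
  i≡j = FinP.toℕ-injective (≤-antisym i≤j (+-cancelʳ-≤ (rank x) _ _
    (≤-trans (+-monoʳ-≤ (toℕ j) (rank-mono le)) (≤-reflexive (sym e)))))

rank-++ : ∀ {m} (x : Point t m) (y : Point t n) → rank (x ++ᵛ y) ≡ rank x + rank y
rank-++ []      y = refl
rank-++ (i ∷ x) y = trans (cong (toℕ i +_) (rank-++ x y)) (sym (+-assoc (toℕ i) (rank x) (rank y)))

flip : Point t n → Point t n
flip = mapᵛ opposite

flip-involutive : (x : Point t n) → flip (flip x) ≡ x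
flip-involutive []      = refl
flip-involutive (i ∷ x) = cong₂ _∷_ (FinP.opposite-involutive i) (flip-involutive x)

rank-flip : (x : Point (suc t) n) → rank x + rank (flip x) ≡ n * t
rank-flip [] = refl
rank-flip {t} (i ∷ x) = trans (+-interchange (toℕ i) (rank x) (toℕ (opposite i)) (rank (flip x)))
  (cong₂ _+_ (trans (cong (toℕ i +_) (FinP.opposite-prop i)) (m+[n∸m]≡n (FinP.toℕ≤pred[n] i))) (rank-flip x))

level : (t n m : ℕ) → ℕ
level t n m = ∑ᵖ {t} {n} (λ x → 𝟙 (rank x ≟ m))

level≤α : ∀ t n m → level t n m ≤ α t n
level≤α t n m = antichain-size≤α {t} {n} (λ x → rank x ≟ m) λ p q le → rank-strict le (trans p (sym q))

-- Symmetric chain decompositions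

-- Only the indices up to `top` belong to the chain, although `point` is total. The last field says
-- that the lowest and the highest rank add up to n t.
record SymmetricChain (t n : ℕ) : Set where
  field
    point     : ℕ → Point (suc t) n
    base top : ℕ
    monotone  : ∀ {i j} → i ≤ j → point i ≼ point j
    rank-point : ∀ {i} → i ≤ top → rank (point i) ≡ base + i
    symmetric : base + (base + top) ≡ n * t

open SymmetricChain

∑ᶜ : SymmetricChain t n → (Point (suc t) n → ℕ) → ℕ
∑ᶜ C f = ∑< (suc (top C)) (f ∘ point C)

-- A product of chains with p and q points. The 2 in `symmetric` avoids p - 1 and q - 1, so that an
-- exhausted grid, with p or q equal to 0, is still a value.
record Grid (t n p q : ℕ) : Set where
  field
    cell  : ℕ → ℕ → Point (suc t) n
    base : ℕ
    monotone : ∀ {i i′ j j′} → i ≤ i′ → j ≤ j′ → cell i j ≼ cell i′ j′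
    rank-cell : ∀ {i j} → i < p → j < q → rank (cell i j) ≡ base + (i + j)
    symmetric : base + (base + (p + q)) ≡ 2 + n * t

-- The L-shaped path along i = 0 and then along j = q. It joins the lowest to the highest corner,
-- hence inherits their symmetry; the truncations in `z ∸ q` and `z ⊓ q` treat both legs at once.
hook : ∀ {p q} → Grid t n (suc p) (suc q) → SymmetricChain t n
hook {p = p} {q} G = record
  { point = λ z → G.cell (z ∸ q) (z ⊓ q)
  ; base = G.base
  ; top = q + p
  ; monotone = λ i≤j → G.monotone (∸-monoˡ-≤ q i≤j) (⊓-monoˡ-≤ q i≤j)
  ; rank-point = λ {i} i≤ → trans
      (G.rank-cell (s≤s (≤-trans (∸-monoˡ-≤ q i≤) (≤-reflexive (m+n∸m≡n q p)))) (s≤s (m⊓n≤n i q)))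
      (cong (G.base +_) (trans (+-comm (i ∸ q) (i ⊓ q)) (trans (cong (_+ (i ∸ q)) (⊓-comm i q)) (m⊓n+n∸m≡n q i))))
  ; symmetric = +-cancelˡ-≡ 2 _ _ (trans (shuffle G.base p q) G.symmetric)
  }
  where
  module G = Grid G
  shuffle : ∀ s p q → 2 + (s + (s + (q + p))) ≡ s + (s + (suc p + suc q))
  shuffle = solve-∀

-- What the hook leaves: without the line i = 0 the lowest rank rises by 1, without the line j = q
-- the highest falls by 1.
inner : ∀ {p q} → Grid t n (suc p) (suc q) → Grid t n p q
inner {p = p} {q} G = record
  { cell = λ i j → G.cell (suc i) j
  ; base = suc G.base
  ; monotone = λ i≤ j≤ → G.monotone (s≤s i≤) j≤
  ; rank-cell = λ {i} {j} i< j< → trans (G.rank-cell (s≤s i<) (m≤n⇒m≤1+n j<)) (+-suc G.base (i + j))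
  ; symmetric = trans (shuffle G.base p q) G.symmetric
  }
  where
  module G = Grid G
  shuffle : ∀ s p q → suc s + (suc s + (p + q)) ≡ s + (s + (suc p + suc q))
  shuffle = solve-∀

hooks : ∀ p q → Grid t n p q → List (SymmetricChain t n)
hooks zero    q       G = []
hooks (suc p) zero    G = []
hooks (suc p) (suc q) G = hook G ∷ hooks p q (inner G)

-- That the hooks partition the grid is expressed as an identity for arbitrary weights f, the form
-- in which it is applied.
∑-hooks : ∀ p q (G : Grid t n p q) f →
          ∑ (hooks p q G) (λ C → ∑ᶜ C f) ≡ ∑< p (λ i → ∑< q (λ j → f (Grid.cell G i j)))
∑-hooks zero    q       G f = refl
∑-hooks (suc p) zero    G f = sym (∑-zero (upTo (suc p)))
∑-hooks (suc p) (suc q) G f = begin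
  ∑< (suc (q + p)) (λ z → f (cell (z ∸ q) (z ⊓ q))) + ∑ (hooks p q (inner G)) (λ C → ∑ᶜ C f)
    ≡⟨ cong₂ _+_ (∑<-+ (suc q) p _) (∑-hooks p q (inner G) f) ⟩
  ∑< (suc q) (λ z → f (cell (z ∸ q) (z ⊓ q))) + ∑< p (λ i → f (cell (suc q + i ∸ q) ((suc q + i) ⊓ q))) + rest
    ≡⟨ cong (_+ rest) (cong₂ _+_
         (∑<-cong-< (suc q) λ { {z} (s≤s z≤q) → cong f (cong₂ cell (m≤n⇒m∸n≡0 z≤q) (m≤n⇒m⊓n≡m z≤q)) })
         (∑-cong (upTo p) λ i → cong f (cong₂ cell
           (trans (cong (_∸ q) (sym (+-suc q i))) (m+n∸m≡n q (suc i)))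
           (m≥n⇒m⊓n≡n (≤-trans (m≤m+n q (suc i)) (≤-reflexive (+-suc q i))))))) ⟩
  row + ∑< p (λ i → f (cell (suc i) q)) + rest
    ≡⟨ +-assoc row _ rest ⟩
  row + (∑< p (λ i → f (cell (suc i) q)) + rest)
    ≡⟨ cong (row +_) (trans (+-comm _ rest) (sym (∑-+ (upTo p) _ _))) ⟩
  row + ∑< p (λ i → ∑< q (λ j → f (cell (suc i) j)) + f (cell (suc i) q))
    ≡⟨ cong (row +_) (∑-cong (upTo p) λ i → sym (∑<-snoc q λ j → f (cell (suc i) j))) ⟩
  row + ∑< p (λ i → ∑< (suc q) (λ j → f (cell (suc i) j)))
    ≡⟨ ∑<-suc p _ ⟨
  ∑< (suc p) (λ i → ∑< (suc q) (λ j → f (cell i j))) ∎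
  where
  open ≡-Reasoning
  open Grid G using (cell)
  row rest : ℕ
  row  = ∑< (suc q) (λ z → f (cell 0 z))
  rest = ∑< p (λ i → ∑< q (λ j → f (cell (suc i) j)))

-- Saturating at t keeps the cells of a grid defined and monotone for all indices.
clamp : ∀ t → ℕ → Fin (suc t)
clamp t       zero    = zero
clamp zero    (suc j) = zero
clamp (suc t) (suc j) = suc (clamp t j)

toℕ-clamp : ∀ {j} → j ≤ t → toℕ (clamp t j) ≡ j
toℕ-clamp z≤n     = refl
toℕ-clamp (s≤s p) = cong suc (toℕ-clamp p)

clamp-mono : ∀ t {i j} → i ≤ j → toℕ (clamp t i) ≤ toℕ (clamp t j)
clamp-mono t       z≤n     = z≤n
clamp-mono zero    (s≤s p) = z≤n
clamp-mono (suc t) (s≤s p) = s≤s (clamp-mono t p)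

clamp-toℕ : (i : Fin (suc t)) → clamp t (toℕ i) ≡ i
clamp-toℕ i = FinP.toℕ-injective (toℕ-clamp (FinP.toℕ≤pred[n] i))

chain×line : SymmetricChain t n → Σ (ℕ × ℕ) λ (p , q) → Grid t (suc n) p q
chain×line {t} {n} C = (suc (top C) , suc t) , record
  { cell = λ i j → clamp t j ∷ point C i
  ; base = base C
  ; monotone = λ i≤ j≤ → clamp-mono t j≤ ∷ monotone C i≤
  ; rank-cell = λ { {i} {j} (s≤s i≤) (s≤s j≤) →
      trans (cong₂ _+_ (toℕ-clamp j≤) (rank-point C i≤)) (shuffle₁ j (base C) i) }
  ; symmetric = trans (shuffle₂ (base C) (top C) t) (cong (λ m → 2 + (t + m)) (symmetric C))
  }
  where
  shuffle₁ : ∀ j s i → j + (s + i) ≡ s + (i + j)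
  shuffle₁ = solve-∀
  shuffle₂ : ∀ s l t → s + (s + (suc l + suc t)) ≡ 2 + (t + (s + (s + l)))
  shuffle₂ = solve-∀

-- The decomposition of de Bruijn, Tengbergen and Kruyswijk, built one coordinate at a time: a chain
-- times a line is a grid, and a grid splits into hooks.
chains : ∀ t n → List (SymmetricChain t n)
chains t zero    = record
  { point = λ _ → [] ; base = 0 ; top = 0 ; monotone = λ _ → []
  ; rank-point = λ { z≤n → refl } ; symmetric = refl } ∷ []
chains t (suc n) = concatMap (λ C → let (p , q) , G = chain×line C in hooks p q G) (chains t n)

∑-chains : ∀ t n (f : Point (suc t) n → ℕ) → ∑ (chains t n) (λ C → ∑ᶜ C f) ≡ ∑ᵖ f
∑-chains t zero    f = +-identityʳ _
∑-chains t (suc n) f = begin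
  ∑ (chains t (suc n)) (λ C → ∑ᶜ C f)
    ≡⟨ ∑-concatMap _ (chains t n) _ ⟩
  ∑ (chains t n) (λ C → let (p , q) , G = chain×line C in ∑ (hooks p q G) (λ D → ∑ᶜ D f))
    ≡⟨ ∑-cong (chains t n) (λ C → trans (∑-hooks (suc (top C)) (suc t) (proj₂ (chain×line C)) f) (columns C)) ⟩
  ∑ (chains t n) (λ C → ∑ᶜ C (λ x → ∑ (allFin (suc t)) (λ i → f (i ∷ x))))
    ≡⟨ ∑-chains t n _ ⟩
  ∑ᵖ (λ x → ∑ (allFin (suc t)) (λ i → f (i ∷ x)))
    ≡⟨ ∑-swap (allPoints (suc t) n) (allFin (suc t)) (λ x i → f (i ∷ x)) ⟩
  ∑ (allFin (suc t)) (λ i → ∑ᵖ (λ x → f (i ∷ x)))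
    ≡⟨ ∑ᵖ-∷ f ⟨
  ∑ᵖ f ∎
  where
  open ≡-Reasoning
  columns : ∀ C → ∑< (suc (top C)) (λ i → ∑< (suc t) (λ j → f (clamp t j ∷ point C i))) ≡
                  ∑ᶜ C (λ x → ∑ (allFin (suc t)) (λ i → f (i ∷ x)))
  columns C = ∑-cong (upTo (suc (top C))) λ i → trans (sym (∑-allFin (suc t) _))
    (∑-cong (allFin (suc t)) λ k → cong (λ j → f (j ∷ point C i)) (clamp-toℕ k))

-- Every symmetric chain has a point on the middle level and at most one point in a given antichain.
α≤middle-level : ∀ t n → α (suc t) n ≤ level (suc t) n ⌈ n * t /2⌉
α≤middle-level t n = α≤ λ A anti → begin
  length A                                       ≡⟨ antichain-length anti ⟩
  ∑ᵖ (λ x → 𝟙 (x ∈ᵖ? A))                          ≡⟨ ∑-chains t n _ ⟨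
  ∑ (chains t n) (λ C → ∑ᶜ C (λ x → 𝟙 (x ∈ᵖ? A))) ≤⟨ ∑-mono (chains t n) (λ C → ≤-trans (meets-once anti C) (meets-middle C)) ⟩
  ∑ (chains t n) (λ C → ∑ᶜ C (λ x → 𝟙 (rank x ≟ m))) ≡⟨ ∑-chains t n _ ⟩
  level (suc t) n m                              ∎
  where
  open ≤-Reasoning
  m = ⌈ n * t /2⌉
  meets-once : ∀ {A} → IsAntichain A → ∀ C → ∑ᶜ C (λ x → 𝟙 (x ∈ᵖ? A)) ≤ 1
  meets-once {A} anti C = ∑<-at-most-one (suc (top C)) (λ i → point C i ∈ᵖ? A)
    λ { {i} {j} i<j (s≤s j≤) p q → contradiction
      (+-cancelˡ-≡ (base C) i j (trans (sym (rank-point C (≤-trans (<⇒≤ i<j) j≤)))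
        (trans (cong rank (antichain-∈ anti p q (monotone C (<⇒≤ i<j)))) (rank-point C j≤))))
      (<⇒≢ i<j) }
  ⌈s+s+l⌉ : ∀ s l → ⌈ s + (s + l) /2⌉ ≡ s + ⌈ l /2⌉
  ⌈s+s+l⌉ zero    l = refl
  ⌈s+s+l⌉ (suc s) l = trans (cong (λ k → ⌈ suc k /2⌉) (+-suc s (s + l))) (cong suc (⌈s+s+l⌉ s l))
  meets-middle : ∀ C → 1 ≤ ∑ᶜ C (λ x → 𝟙 (rank x ≟ m))
  meets-middle C = ≤-trans
    (≤-reflexive (sym (𝟙-true (rank (point C ⌈ top C /2⌉) ≟ m)
      (trans (rank-point C (⌈n/2⌉≤n (top C)))
        (trans (sym (⌈s+s+l⌉ (base C) (top C))) (cong ⌈_/2⌉ (symmetric C)))))))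
    (∑-member _ (∈-upTo⁺ (s≤s (⌈n/2⌉≤n (top C)))))

-- Log-concavity of the level sizes

-- For each s the ratio f (j + s) / f j does not increase with j. Unlike the condition on three
-- consecutive values, this also rules out internal zeros.
LogConcave : (ℕ → ℕ) → Set
LogConcave f = ∀ {p q} s → p ≤ q → f p * f (q + s) ≤ f (p + s) * f q

-- The effect on level sizes of one more coordinate with values in [t].
window : ℕ → (ℕ → ℕ) → ℕ → ℕ
window t f j = ∑< t (λ i → f (j + i))

window-shift : ∀ t f j → window t f (suc j) + f j ≡ window t f j + f (j + t)
window-shift t f j = begin
  ∑< t (λ i → f (suc j + i)) + f j       ≡⟨ +-comm _ (f j) ⟩
  f j + ∑< t (λ i → f (suc j + i))       ≡⟨ cong₂ _+_ (cong f (sym (+-identityʳ j))) (∑-cong (upTo t) λ i → cong f (sym (+-suc j i))) ⟩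
  f (j + 0) + ∑< t (λ i → f (j + suc i)) ≡⟨ ∑<-suc t (λ i → f (j + i)) ⟨
  ∑< (suc t) (λ i → f (j + i))           ≡⟨ ∑<-snoc t (λ i → f (j + i)) ⟩
  window t f j + f (j + t)               ∎
  where open ≡-Reasoning

-- Writing W (j + 1) = W j + f (j + t) - f j on both sides, the products W p · W q cancel; the two
-- comparisons that remain, `outer` and `inner′`, hold term by term.
window-step : ∀ t f {p q} → LogConcave f → p ≤ q →
              window t f p * window t f (suc q) ≤ window t f (suc p) * window t f q
window-step t f {p} {q} lc p≤q = cancel
  where
  open ≤-Reasoning
  W : ℕ → ℕ
  W = window t f
  outer : W p * f (q + t) ≤ f (p + t) * W q
  outer = begin
    W p * f (q + t)                       ≡⟨ ∑-*ʳ (f (q + t)) (upTo t) _ ⟨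
    ∑< t (λ i → f (p + i) * f (q + t))    ≤⟨ ∑<-mono-< t (λ {i} i<t →
        subst₂ (λ a b → f (p + i) * f b ≤ f a * f (q + i)) (tail p (<⇒≤ i<t)) (tail q (<⇒≤ i<t))
          (lc (t ∸ i) (+-monoˡ-≤ i p≤q))) ⟩
    ∑< t (λ i → f (p + t) * f (q + i))    ≡⟨ ∑-*ˡ (f (p + t)) (upTo t) _ ⟩
    f (p + t) * W q                       ∎
    where
    tail : ∀ a {i} → i ≤ t → a + i + (t ∸ i) ≡ a + t
    tail a {i} i≤t = trans (+-assoc a i (t ∸ i)) (cong (a +_) (m+[n∸m]≡n i≤t))
  inner′ : f p * W q ≤ W p * f q
  inner′ = begin
    f p * W q                             ≡⟨ ∑-*ˡ (f p) (upTo t) _ ⟨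
    ∑< t (λ i → f p * f (q + i))          ≤⟨ ∑-mono (upTo t) (λ i → lc i p≤q) ⟩
    ∑< t (λ i → f (p + i) * f q)          ≡⟨ ∑-*ʳ (f q) (upTo t) _ ⟩
    W p * f q                             ∎
  distrib : ∀ a b c d → a * b + a * c + d ≡ a * (b + c) + d
  distrib = solve-∀
  rearrange : ∀ a b c d → a * (b + c) + d * b ≡ a * b + (a * c + d * b)
  rearrange = solve-∀
  rearrange′ : ∀ a b c d → a * b + (d * b + a * c) ≡ (a + d) * b + a * c
  rearrange′ = solve-∀
  rearrange″ : ∀ a b c d → (a + c) * b + d ≡ a * b + d + c * b
  rearrange″ = solve-∀
  cancel : W p * W (suc q) ≤ W (suc p) * W q
  cancel = +-cancelʳ-≤ (W p * f q) _ _ (+-cancelʳ-≤ (f p * W q) _ _ (begin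
    W p * W (suc q) + W p * f q + f p * W q    ≡⟨ distrib (W p) (W (suc q)) (f q) _ ⟩
    W p * (W (suc q) + f q) + f p * W q        ≡⟨ cong (λ w → W p * w + f p * W q) (window-shift t f q) ⟩
    W p * (W q + f (q + t)) + f p * W q        ≡⟨ rearrange (W p) (W q) (f (q + t)) (f p) ⟩
    W p * W q + (W p * f (q + t) + f p * W q)  ≤⟨ +-monoʳ-≤ (W p * W q) (+-mono-≤ outer inner′) ⟩
    W p * W q + (f (p + t) * W q + W p * f q)  ≡⟨ rearrange′ (W p) (W q) (f q) (f (p + t)) ⟩
    (W p + f (p + t)) * W q + W p * f q        ≡⟨ cong (λ w → w * W q + W p * f q) (window-shift t f p) ⟨
    (W (suc p) + f p) * W q + W p * f q        ≡⟨ rearrange″ (W (suc p)) (W q) (f p) _ ⟩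
    W (suc p) * W q + W p * f q + f p * W q    ∎))

-- Moving one unit from the larger argument to the smaller does not decrease the product; such moves
-- are repeated until s is used up or p meets q.
window-logConcave : ∀ t f → LogConcave f → LogConcave (window t f)
window-logConcave t f lc {p} {q} zero p≤q =
  ≤-reflexive (cong₂ (λ a b → window t f a * window t f b) (sym (+-identityʳ p)) (+-identityʳ q))
window-logConcave t f lc {p} {q} (suc s) p≤q with m≤n⇒m<n∨m≡n p≤q
... | inj₂ refl = ≤-reflexive (*-comm (window t f p) _)
... | inj₁ p<q  = begin
  W p * W (q + suc s)   ≡⟨ cong (λ k → W p * W k) (+-suc q s) ⟩
  W p * W (suc (q + s)) ≤⟨ window-step t f lc (≤-trans p≤q (m≤m+n q s)) ⟩
  W (suc p) * W (q + s) ≤⟨ window-logConcave t f lc s p<q ⟩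
  W (suc p + s) * W q   ≡⟨ cong (λ k → W k * W q) (+-suc p s) ⟨
  W (p + suc s) * W q   ∎
  where
  open ≤-Reasoning
  W = window t f

-- The level sizes read downwards from rank m. The equation rank x + j = m gives the value 0 for j >
-- m, where the truncated m ∸ j would repeat level 0.
descend : (t n m j : ℕ) → ℕ
descend t n m j = ∑ᵖ {t} {n} (λ x → 𝟙 (rank x + j ≟ m))

descend-suc : ∀ t n m j → descend t (suc n) m j ≡ window t (descend t n m) j
descend-suc t n m j = trans (∑ᵖ-∷ {t} {n} _)
  (trans (∑-cong (allFin t) λ i → ∑-cong (allPoints t n) λ x →
      cong (λ k → 𝟙 (k ≟ m)) (shuffle (toℕ i) (rank x) j))
    (∑-allFin t (λ i → descend t n m (j + i))))
  where
  shuffle : ∀ i r j → i + r + j ≡ r + (j + i)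
  shuffle = solve-∀

descend-logConcave : ∀ t n m → LogConcave (descend t n m)
descend-logConcave t zero m {p} {q} s p≤q with p ≟ m | q + s ≟ m
... | no _     | _ = z≤n
... | yes refl | no _ = z≤n
... | yes refl | yes q+s≡p = ≤-reflexive (cong₂ (λ a b → (a + 0) * (b + 0))
  (sym (𝟙-true (p + s ≟ p) (trans (cong (p +_) s≡0) (+-identityʳ p)))) (sym (𝟙-true (q ≟ p) (sym p≡q))))
  where
  p≡q : p ≡ q
  p≡q = ≤-antisym p≤q (≤-trans (m≤m+n q s) (≤-reflexive q+s≡p))
  s≡0 : s ≡ 0
  s≡0 = +-cancelˡ-≡ q s 0 (trans q+s≡p (trans p≡q (sym (+-identityʳ q))))
descend-logConcave t (suc n) m {p} {q} s p≤q
  rewrite descend-suc t n m p | descend-suc t n m (q + s) | descend-suc t n m (p + s) | descend-suc t n m q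
  = window-logConcave t (descend t n m) (descend-logConcave t n m) s p≤q

-- Comparing widths of hypergrids of different dimensions

first-small : (g : ℕ → ℕ) (M l : ℕ) →
              ∃ λ w → w ≤ l × (∀ {j} → j < w → M ≤ 2 * g j) × (w ≡ l ⊎ 2 * g w < M)
first-small g M zero = 0 , z≤n , (λ ()) , inj₁ refl
first-small g M (suc l) with first-small g M l
... | w , w≤l , large , inj₂ small = w , m≤n⇒m≤1+n w≤l , large , inj₂ small
... | w , w≤l , large , inj₁ refl with M ≤? 2 * g l
...   | no gl≰  = l , n≤1+n l , large , inj₂ (≰⇒> gl≰)
...   | yes gl = suc l , ≤-refl , (λ { (s≤s j≤l) → extend (m≤n⇒m<n∨m≡n j≤l) }) , inj₁ refl
  where
  extend : ∀ {j} → j < l ⊎ j ≡ l → M ≤ 2 * g j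
  extend (inj₁ j<l)  = large j<l
  extend (inj₂ refl) = gl

-- Past the first index w with 2 g(w) < g(0), log-concavity halves g every w steps,
-- so the indices below w carry half of the mass.
logConcave-∑-squares : ∀ g → LogConcave g → ∀ l → g 0 * ∑< l g ≤ 4 * ∑< l (λ j → g j * g j)
logConcave-∑-squares g lc l = begin
  g 0 * T                          ≤⟨ *-monoʳ-≤ (g 0) (half end) ⟩
  g 0 * (2 * H)                    ≡⟨ shuffle (g 0) H ⟩
  2 * (g 0 * H)                    ≡⟨ cong (2 *_) (∑-*ˡ (g 0) (upTo w) g) ⟨
  2 * ∑< w (λ j → g 0 * g j)       ≤⟨ *-monoʳ-≤ 2 (∑<-mono-< w λ {j} j<w → *-monoˡ-≤ (g j) (large j<w)) ⟩
  2 * ∑< w (λ j → 2 * g j * g j)   ≡⟨ cong (2 *_) (trans (∑-cong (upTo w) λ j → *-assoc 2 (g j) (g j)) (∑-*ˡ 2 (upTo w) _)) ⟩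
  2 * (2 * ∑< w (λ j → g j * g j)) ≡⟨ *-assoc 2 2 (∑< w (λ j → g j * g j)) ⟨
  4 * ∑< w (λ j → g j * g j)       ≤⟨ *-monoʳ-≤ 4 (∑<-length w l _ w≤l) ⟩
  4 * ∑< l (λ j → g j * g j)       ∎
  where
  open ≤-Reasoning
  search = first-small g (g 0) l
  w = proj₁ search
  w≤l : w ≤ l
  w≤l = proj₁ (proj₂ search)
  large : ∀ {j} → j < w → g 0 ≤ 2 * g j
  large = proj₁ (proj₂ (proj₂ search))
  end : w ≡ l ⊎ 2 * g w < g 0
  end = proj₂ (proj₂ (proj₂ search))
  T H : ℕ
  T = ∑< l g
  H = ∑< w g
  shuffle : ∀ a b → a * (2 * b) ≡ 2 * (a * b)
  shuffle = solve-∀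
  half : w ≡ l ⊎ 2 * g w < g 0 → T ≤ 2 * H
  half (inj₁ w≡l) = subst (λ k → T ≤ 2 * ∑< k g) (sym w≡l) (m≤m+n T _)
  half (inj₂ small) = +-cancelʳ-≤ T _ _ (begin
    T + T                     ≡⟨ cong (λ k → k + k) split ⟩
    (H + R) + (H + R)         ≡⟨ double H R ⟩
    2 * H + 2 * R             ≤⟨ +-monoʳ-≤ (2 * H) (begin
      2 * R                                   ≡⟨ ∑-*ˡ 2 (upTo (l ∸ w)) _ ⟨
      ∑< (l ∸ w) (λ j → 2 * g (w + j))        ≤⟨ ∑-mono (upTo (l ∸ w)) halves ⟩
      ∑< (l ∸ w) g                            ≤⟨ ∑<-length (l ∸ w) l g (m∸n≤m l w) ⟩
      T                                       ∎) ⟩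
    2 * H + T                 ∎)
    where
    R = ∑< (l ∸ w) (λ j → g (w + j))
    split : T ≡ H + R
    split = trans (cong (λ k → ∑< k g) (sym (m+[n∸m]≡n w≤l))) (∑<-+ w (l ∸ w) g)
    double : ∀ a b → (a + b) + (a + b) ≡ 2 * a + 2 * b
    double = solve-∀
    halves : ∀ j → 2 * g (w + j) ≤ g j
    halves j = *-cancelˡ-≤ (g 0) {{>-nonZero (≤-<-trans z≤n small)}} (begin
      g 0 * (2 * g (w + j))   ≡⟨ shuffle (g 0) (g (w + j)) ⟩
      2 * (g 0 * g (w + j))   ≡⟨ cong (λ k → 2 * (g 0 * g k)) (+-comm w j) ⟩
      2 * (g 0 * g (j + w))   ≤⟨ *-monoʳ-≤ 2 (lc w z≤n) ⟩
      2 * (g w * g j)         ≡⟨ *-assoc 2 (g w) (g j) ⟨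
      2 * g w * g j           ≤⟨ *-monoˡ-≤ (g j) (<⇒≤ small) ⟩
      g 0 * g j               ∎)

∑<-hits : ∀ r m → ∑< (suc m) (λ j → 𝟙 (r + j ≟ m)) ≡ 𝟙 (r ≤? m)
∑<-hits r m with r ≤? m
... | yes r≤m = ≤-antisym (hits≤1 (suc m)) (≤-trans
  (≤-reflexive (sym (𝟙-true (r + (m ∸ r) ≟ m) (m+[n∸m]≡n r≤m))))
  (∑-member (λ j → 𝟙 (r + j ≟ m)) (∈-upTo⁺ (s≤s (m∸n≤m m r)))))
  where
  hits≤1 : ∀ l → ∑< l (λ j → 𝟙 (r + j ≟ m)) ≤ 1
  hits≤1 l = ∑<-at-most-one l (λ j → r + j ≟ m)
    λ {i} {j} i<j _ p q → contradiction (+-cancelˡ-≡ r i j (trans p (sym q))) (<⇒≢ i<j)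
... | no r≰m = trans (∑-cong (upTo (suc m)) λ j →
    𝟙-false (r + j ≟ m) (λ e → r≰m (≤-trans (m≤m+n r j) (≤-reflexive e)))) (∑-zero (upTo (suc m)))

-- Since m is at least half of the maximal rank, x or `flip x` has rank at most m.
below-middle : ∀ t n m → n * t ≤ m + m → suc t ^ n ≤ 2 * ∑ᵖ {suc t} {n} (λ x → 𝟙 (rank x ≤? m))
below-middle t n m nt≤2m = begin
  suc t ^ n                                                          ≡⟨ trans (∑ᵖ-const {suc t} {n} 1) (*-identityʳ _) ⟨
  ∑ᵖ {suc t} {n} (λ _ → 1)                                            ≤⟨ ∑-mono (allPoints (suc t) n) one-of ⟩
  ∑ᵖ {suc t} {n} (λ x → 𝟙 (rank x ≤? m) + 𝟙 (rank (flip x) ≤? m))                 ≡⟨ ∑-+ (allPoints (suc t) n) _ _ ⟩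
  L + ∑ᵖ {suc t} {n} (λ x → 𝟙 (rank (flip x) ≤? m))                   ≡⟨ cong (L +_) (∑ᵖ-involution {suc t} {n} flip flip-involutive _) ⟩
  L + L                                                              ≡⟨ cong (L +_) (+-identityʳ L) ⟨
  2 * L                                                              ∎
  where
  open ≤-Reasoning
  L = ∑ᵖ {suc t} {n} (λ x → 𝟙 (rank x ≤? m))
  one-of : (x : Point (suc t) n) → 1 ≤ 𝟙 (rank x ≤? m) + 𝟙 (rank (flip x) ≤? m)
  one-of x with rank x ≤? m
  ... | yes _ = s≤s z≤n
  ... | no x≰m = ≤-reflexive (sym (𝟙-true (rank (flip x) ≤? m)
    (<⇒≤ (+-cancelˡ-< (rank x) _ _ (≤-<-trans (≤-reflexive (rank-flip x)) (≤-<-trans nt≤2m (+-monoˡ-< m (≰⇒> x≰m))))))))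

-- Complementing the second half turns rank x + rank y = n t into rank x = rank y.
level-double : ∀ t n → level (suc t) (n + n) (n * t) ≡ ∑ᵖ {suc t} {n} (λ x → level (suc t) n (rank x))
level-double t n = begin
  level (suc t) (n + n) (n * t)                                     ≡⟨ ∑ᵖ-++ {suc t} {n} n _ ⟩
  ∑ᵖ {suc t} {n} (λ x → ∑ᵖ {suc t} {n} (λ y → 𝟙 (rank (x ++ᵛ y) ≟ n * t)))       ≡⟨ ∑-cong L (λ x → sym (∑ᵖ-involution {suc t} {n} flip flip-involutive (λ y → 𝟙 (rank (x ++ᵛ y) ≟ n * t)))) ⟩
  ∑ᵖ {suc t} {n} (λ x → ∑ᵖ {suc t} {n} (λ y → 𝟙 (rank (x ++ᵛ flip y) ≟ n * t)))  ≡⟨ ∑-cong L (λ x → ∑-cong L (λ y → same-rank x y)) ⟩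
  ∑ᵖ {suc t} {n} (λ x → level (suc t) n (rank x))                   ∎
  where
  open ≡-Reasoning
  L = allPoints (suc t) n
  same-rank : ∀ x y → 𝟙 (rank (x ++ᵛ flip y) ≟ n * t) ≡ 𝟙 (rank y ≟ rank x)
  same-rank x y = 𝟙-cong _ _
    (λ e → sym (+-cancelʳ-≡ (rank (flip y)) _ _ (trans (sym (rank-++ x (flip y))) (trans e (sym (rank-flip y))))))
    (λ e → trans (rank-++ x (flip y)) (trans (cong (_+ rank (flip y)) (sym e)) (rank-flip y)))

-- Each square counts the ordered pairs of points on one level of rank at most m; the right side
-- counts such pairs on all levels.
∑-squares≤ : ∀ t n m → ∑< (suc m) (λ j → descend t n m j * descend t n m j) ≤ ∑ᵖ {t} {n} (λ x → level t n (rank x))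
∑-squares≤ t n m = begin
  ∑< (suc m) (λ j → descend t n m j * descend t n m j)
    ≡⟨ ∑-cong (upTo (suc m)) (λ j → sym (∑-*ʳ (descend t n m j) (allPoints t n) _)) ⟩
  ∑< (suc m) (λ j → ∑ᵖ {t} {n} (λ x → 𝟙 (rank x + j ≟ m) * descend t n m j))
    ≡⟨ ∑-swap (upTo (suc m)) (allPoints t n) _ ⟩
  ∑ᵖ {t} {n} (λ x → ∑< (suc m) (λ j → 𝟙 (rank x + j ≟ m) * descend t n m j))
    ≤⟨ ∑-mono (allPoints t n) (λ x → ∑-mono (upTo (suc m)) (λ j → 𝟙-*-mono (rank x + j ≟ m) (same-level x j))) ⟩
  ∑ᵖ {t} {n} (λ x → ∑< (suc m) (λ j → 𝟙 (rank x + j ≟ m) * level t n (rank x)))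
    ≡⟨ ∑-cong (allPoints t n) (λ x → trans (∑-*ʳ (level t n (rank x)) (upTo (suc m)) (λ j → 𝟙 (rank x + j ≟ m)))
         (cong (_* level t n (rank x)) (∑<-hits (rank x) m))) ⟩
  ∑ᵖ {t} {n} (λ x → 𝟙 (rank x ≤? m) * level t n (rank x))
    ≤⟨ ∑-mono (allPoints t n) (λ x → ≤-trans (*-monoˡ-≤ (level t n (rank x)) (𝟙≤1 (rank x ≤? m))) (≤-reflexive (*-identityˡ _))) ⟩
  ∑ᵖ {t} {n} (λ x → level t n (rank x)) ∎
  where
  open ≤-Reasoning
  same-level : ∀ x j → rank x + j ≡ m → descend t n m j ≤ level t n (rank x)
  same-level x j e = ∑-mono (allPoints t n) λ y → 𝟙-mono _ _ λ e′ → +-cancelʳ-≡ j (rank y) (rank x) (trans e′ (sym e))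

-- The 8 is the 2 of `below-middle` times the 4 of `logConcave-∑-squares`.
α*size≤level-double : ∀ t n → α (suc t) n * suc t ^ n ≤ 8 * level (suc t) (n + n) (n * t)
α*size≤level-double t n = begin
  α (suc t) n * suc t ^ n      ≤⟨ *-mono-≤ (α≤middle-level t n) (below-middle t n m (≤-trans
                                    (≤-reflexive (sym (⌊n/2⌋+⌈n/2⌉≡n (n * t)))) (+-monoˡ-≤ m (⌊n/2⌋≤⌈n/2⌉ (n * t))))) ⟩
  level (suc t) n m * (2 * ∑ᵖ {suc t} {n} (λ x → 𝟙 (rank x ≤? m)))
                               ≡⟨ cong₂ (λ a b → a * (2 * b)) level≡g below≡∑g ⟩
  g 0 * (2 * ∑< (suc m) g)     ≡⟨ shuffle (g 0) (∑< (suc m) g) ⟩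
  2 * (g 0 * ∑< (suc m) g)     ≤⟨ *-monoʳ-≤ 2 (logConcave-∑-squares g (descend-logConcave (suc t) n m) (suc m)) ⟩
  2 * (4 * ∑< (suc m) (λ j → g j * g j)) ≡⟨ *-assoc 2 4 (∑< (suc m) (λ j → g j * g j)) ⟨
  8 * ∑< (suc m) (λ j → g j * g j) ≤⟨ *-monoʳ-≤ 8 (∑-squares≤ (suc t) n m) ⟩
  8 * ∑ᵖ {suc t} {n} (λ x → level (suc t) n (rank x)) ≡⟨ cong (8 *_) (level-double t n) ⟨
  8 * level (suc t) (n + n) (n * t) ∎
  where
  open ≤-Reasoning
  m = ⌈ n * t /2⌉
  g = descend (suc t) n m
  shuffle : ∀ a b → a * (2 * b) ≡ 2 * (a * b)
  shuffle = solve-∀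
  level≡g : level (suc t) n m ≡ g 0
  level≡g = ∑-cong (allPoints (suc t) n) λ x → cong (λ k → 𝟙 (k ≟ m)) (sym (+-identityʳ (rank x)))
  below≡∑g : ∑ᵖ {suc t} {n} (λ x → 𝟙 (rank x ≤? m)) ≡ ∑< (suc m) g
  below≡∑g = trans (∑-cong (allPoints (suc t) n) λ x → sym (∑<-hits (rank x) m))
    (∑-swap (allPoints (suc t) n) (upTo (suc m)) _)

-- Given u in [t], the sum u + v determines z = (u + v) mod t, and conversely v is determined by z:
-- replacing the first coordinate z by (u , v) turns rank m into m or m + t.
t*level≤ : ∀ t n m → t * level t (suc n) m ≤ level t (2 + n) m + level t (2 + n) (m + t)
t*level≤ t n m = begin
  t * level t (suc n) m
    ≡⟨ cong (_* level t (suc n) m) (length-tabulate {n = t} (λ i → i)) ⟨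
  length F * level t (suc n) m
    ≡⟨ ∑-const F _ ⟨
  ∑ F (λ u → level t (suc n) m)
    ≤⟨ ∑-mono F (λ u → begin
         level t (suc n) m                                            ≡⟨ ∑ᵖ-∷ {t} {n} _ ⟩
         ∑ F (λ z → ∑ᵖ {t} {n} (λ x → 𝟙 (toℕ z + rank x ≟ m)))         ≡⟨ ∑-swap F L _ ⟩
         ∑ᵖ {t} {n} (λ x → ∑ F (λ z → 𝟙 (toℕ z + rank x ≟ m)))         ≤⟨ ∑-mono L (λ x → residue u (rank x)) ⟩
         ∑ᵖ {t} {n} (λ x → ∑ F (λ v → hit u v (rank x)))               ≡⟨ ∑-swap L F _ ⟩
         ∑ F (λ v → ∑ᵖ {t} {n} (λ x → hit u v (rank x)))               ≡⟨ ∑ᵖ-∷ {t} {n} _ ⟨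
         ∑ᵖ {t} {suc n} (λ x → 𝟙 (toℕ u + rank x ≟ m) + 𝟙 (toℕ u + rank x ≟ m + t)) ∎) ⟩
  ∑ F (λ u → ∑ᵖ {t} {suc n} (λ x → 𝟙 (toℕ u + rank x ≟ m) + 𝟙 (toℕ u + rank x ≟ m + t)))
    ≡⟨ ∑ᵖ-∷ {t} {suc n} _ ⟨
  ∑ᵖ {t} {2 + n} (λ x → 𝟙 (rank x ≟ m) + 𝟙 (rank x ≟ m + t))
    ≡⟨ ∑-+ (allPoints t (2 + n)) _ _ ⟩
  level t (2 + n) m + level t (2 + n) (m + t) ∎
  where
  open ≤-Reasoning
  F = allFin t
  L = allPoints t n
  hit : Fin t → Fin t → ℕ → ℕ
  hit u v r = 𝟙 (toℕ u + (toℕ v + r) ≟ m) + 𝟙 (toℕ u + (toℕ v + r) ≟ m + t)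
  residue : ∀ u r → ∑ F (λ z → 𝟙 (toℕ z + r ≟ m)) ≤ ∑ F (λ v → hit u v r)
  residue u r with r ≤? m | m <? r + t
  ... | no r≰m | _ = ≤-trans (≤-reflexive (trans (∑-cong F λ z → 𝟙-false (toℕ z + r ≟ m)
      λ e → r≰m (≤-trans (m≤n+m r (toℕ z)) (≤-reflexive e))) (∑-zero F))) z≤n
  ... | yes _ | no m≮ = ≤-trans (≤-reflexive (trans (∑-cong F λ z → 𝟙-false (toℕ z + r ≟ m)
      λ e → m≮ (subst₂ _<_ e (+-comm t r) (+-monoˡ-< r (FinP.toℕ<n z)))) (∑-zero F))) z≤n
  ... | yes r≤m | yes m<r+t = ≤-trans at-most (at-least (toℕ u ≤? d))
    where
    -- The only possible z is d. It is answered by v = d - u, which reaches m, or, when u > d, by v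
    -- = d + t - u, which reaches m + t.
    d = m ∸ r
    d+r≡m : d + r ≡ m
    d+r≡m = m∸n+n≡m r≤m
    d<t : d < t
    d<t = +-cancelʳ-< r d t (subst₂ _<_ (sym d+r≡m) (+-comm r t) m<r+t)
    at-most : ∑ F (λ z → 𝟙 (toℕ z + r ≟ m)) ≤ 1
    at-most = ≤-trans (≤-reflexive (∑-allFin t (λ z → 𝟙 (z + r ≟ m))))
      (∑<-at-most-one t (λ z → z + r ≟ m)
        λ {i} {j} i<j _ p q → contradiction (+-cancelʳ-≡ r i j (trans p (sym q))) (<⇒≢ i<j))
    witness : ∀ v (v<t : v < t) → (toℕ u + (v + r) ≡ m ⊎ toℕ u + (v + r) ≡ m + t) → 1 ≤ ∑ F (λ v → hit u v r)
    witness v v<t e = ≤-trans (one (subst (λ k → toℕ u + (k + r) ≡ m ⊎ toℕ u + (k + r) ≡ m + t)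
        (sym (FinP.toℕ-fromℕ< v<t)) e)) (∑-member (λ v → hit u v r) (∈-allFin v′))
      where
      v′ = fromℕ< v<t
      one : (toℕ u + (toℕ v′ + r) ≡ m ⊎ toℕ u + (toℕ v′ + r) ≡ m + t) → 1 ≤ hit u v′ r
      one (inj₁ e) = ≤-trans (≤-reflexive (sym (𝟙-true (toℕ u + (toℕ v′ + r) ≟ m) e))) (m≤m+n _ _)
      one (inj₂ e) = ≤-trans (≤-reflexive (sym (𝟙-true (toℕ u + (toℕ v′ + r) ≟ m + t) e))) (m≤n+m _ (𝟙 (toℕ u + (toℕ v′ + r) ≟ m)))
    at-least : Dec (toℕ u ≤ d) → 1 ≤ ∑ F (λ v → hit u v r)
    at-least (yes u≤d) = witness (d ∸ toℕ u) (≤-<-trans (m∸n≤m d (toℕ u)) d<t)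
      (inj₁ (trans (sym (+-assoc (toℕ u) _ r)) (trans (cong (_+ r) (m+[n∸m]≡n u≤d)) d+r≡m)))
    at-least (no u≰d) = witness (d + t ∸ toℕ u)
      (subst (d + t ∸ toℕ u <_) (m+n∸m≡n (toℕ u) t) (∸-monoˡ-< (+-monoˡ-< t (≰⇒> u≰d)) u≤d+t))
      (inj₂ (trans (sym (+-assoc (toℕ u) _ r)) (trans (cong (_+ r) (m+[n∸m]≡n u≤d+t))
        (trans (shuffle d t r) (cong (_+ t) d+r≡m)))))
      where
      u≤d+t : toℕ u ≤ d + t
      u≤d+t = ≤-trans (<⇒≤ (FinP.toℕ<n u)) (m≤n+m t d)
      shuffle : ∀ d t r → d + t + r ≡ d + r + t
      shuffle = solve-∀

width-even : ∀ t n → α (suc t) n * suc t ^ n + α (suc t) n * suc t ^ n ≤ 32 * α (suc t) (n + n)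
width-even t n = begin
  w + w                        ≤⟨ +-mono-≤ w≤ w≤ ⟩
  8 * A + 8 * A                ≡⟨ *-distribʳ-+ A 8 8 ⟨
  -- The odd case yields 32, and both parities share one constant.
  16 * A                       ≤⟨ *-monoˡ-≤ A (m≤m+n 16 16) ⟩
  32 * A                       ∎
  where
  open ≤-Reasoning
  A = α (suc t) (n + n)
  w = α (suc t) n * suc t ^ n
  w≤ : w ≤ 8 * A
  w≤ = ≤-trans (α*size≤level-double t n) (*-monoʳ-≤ 8 (level≤α (suc t) (n + n) (n * t)))

-- For the split m + (m + 1) both products are at most T times the product in the even case for m.
-- Then `t*level≤` absorbs T by passing to dimension 2 m + 1, at the price of two levels: 32 = 2 · 8
-- · 2.
width-odd : ∀ t n → let m = suc n in
  α (suc t) m * suc t ^ suc m + α (suc t) (suc m) * suc t ^ m ≤ 32 * α (suc t) (suc (m + m))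
width-odd t n = begin
  α T m * T ^ suc m + α T (suc m) * T ^ m ≤⟨ +-monoʳ-≤ (α T m * T ^ suc m) (*-monoˡ-≤ (T ^ m) (α-suc≤ T m)) ⟩
  α T m * (T * T ^ m) + T * α T m * T ^ m ≡⟨ shuffle (α T m) T (T ^ m) ⟩
  2 * (T * (α T m * T ^ m))               ≤⟨ *-monoʳ-≤ 2 (*-monoʳ-≤ T (α*size≤level-double t m)) ⟩
  2 * (T * (8 * level T (m + m) (m * t))) ≡⟨ shuffle′ T (level T (m + m) (m * t)) ⟩
  16 * (T * level T (m + m) (m * t))      ≤⟨ *-monoʳ-≤ 16 (t*level≤ T (n + m) (m * t)) ⟩
  16 * (level T (suc (m + m)) (m * t) + level T (suc (m + m)) (m * t + T))
                                          ≤⟨ *-monoʳ-≤ 16 (+-mono-≤ (level≤α T (suc (m + m)) _) (level≤α T (suc (m + m)) _)) ⟩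
  16 * (A + A)                            ≡⟨ shuffle″ A ⟩
  32 * A                                  ∎
  where
  open ≤-Reasoning
  m = suc n
  T = suc t
  A = α T (suc (m + m))
  shuffle : ∀ a t p → a * (t * p) + t * a * p ≡ 2 * (t * (a * p))
  shuffle = solve-∀
  shuffle′ : ∀ t l → 2 * (t * (8 * l)) ≡ 16 * (t * l)
  shuffle′ = solve-∀
  shuffle″ : ∀ a → 16 * (a + a) ≡ 32 * a
  shuffle″ = solve-∀

-- Inequalities between powers

^-cancelʳ-≤ : ∀ e .{{_ : NonZero e}} {m n} → m ^ e ≤ n ^ e → m ≤ n
^-cancelʳ-≤ e {m} {n} le with m ≤? n
... | yes m≤n = m≤n
... | no m≰n  = contradiction le (<⇒≱ (^-monoˡ-< e (≰⇒> m≰n)))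

^-distribʳ-* : ∀ e m n → (m * n) ^ e ≡ m ^ e * n ^ e
^-distribʳ-* zero    m n = refl
^-distribʳ-* (suc e) m n = trans (cong (m * n *_) (^-distribʳ-* e m n)) (shuffle m n (m ^ e) (n ^ e))
  where
  shuffle : ∀ a b c d → a * b * (c * d) ≡ a * c * (b * d)
  shuffle = solve-∀

-- Bernoulli's inequality (1 + 1/d)^e ≥ 1 + e/d with denominators cleared.
bernoulli : ∀ d e → d ^ e * (d + e) ≤ suc d ^ e * d
bernoulli d zero = ≤-reflexive (cong (1 *_) (+-identityʳ d))
bernoulli d (suc e) = begin
  d * d ^ e * (d + suc e)                  ≤⟨ m≤m+n _ (d ^ e * e) ⟩
  d * d ^ e * (d + suc e) + d ^ e * e      ≡⟨ shuffle d e (d ^ e) ⟩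
  suc d * (d ^ e * (d + e))                ≤⟨ *-monoʳ-≤ (suc d) (bernoulli d e) ⟩
  suc d * (suc d ^ e * d)                  ≡⟨ *-assoc (suc d) (suc d ^ e) d ⟨
  suc d * suc d ^ e * d                    ∎
  where
  open ≤-Reasoning
  shuffle : ∀ d e p → d * p * (d + suc e) + p * e ≡ suc d * (p * (d + e))
  shuffle = solve-∀

2*d^d≤[1+d]^d : ∀ d .{{_ : NonZero d}} → 2 * d ^ d ≤ suc d ^ d
2*d^d≤[1+d]^d d = *-cancelʳ-≤ (2 * d ^ d) (suc d ^ d) d
  (≤-trans (≤-reflexive (shuffle d (d ^ d))) (bernoulli d d))
  where
  shuffle : ∀ d p → 2 * p * d ≡ p * (d + d)
  shuffle = solve-∀

-- Bernoulli's inequality (1 - 1/(d + 1))^e ≥ 1 - e/(d + 1), cleared of denominators; it bounds (1 +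
-- 1/d)^e from above.
bernoulli′ : ∀ d e → suc d ^ e * suc d ≤ d ^ e * suc d + e * suc d ^ e
bernoulli′ d zero = m≤m+n _ 0
bernoulli′ d (suc e) = begin
  suc d * p * suc d                         ≡⟨ *-assoc (suc d) p (suc d) ⟩
  suc d * (p * suc d)                       ≤⟨ *-monoʳ-≤ (suc d) (bernoulli′ d e) ⟩
  suc d * (r * suc d + e * p)               ≡⟨ shuffle d e p r ⟩
  d * r * suc d + (r * suc d + e * (suc d * p)) ≤⟨ +-monoʳ-≤ (d * r * suc d) (+-monoˡ-≤ (e * (suc d * p))
                                                (≤-trans (*-monoˡ-≤ (suc d) (^-monoˡ-≤ e (n≤1+n d))) (≤-reflexive (*-comm p (suc d))))) ⟩
  d * r * suc d + (suc d * p + e * (suc d * p)) ∎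
  where
  open ≤-Reasoning
  p = suc d ^ e
  r = d ^ e
  shuffle : ∀ d e p r → suc d * (r * suc d + e * p) ≡ d * r * suc d + (r * suc d + e * (suc d * p))
  shuffle = solve-∀

[1+d]^e≤2*d^e : ∀ d e → e + e ≤ suc d → suc d ^ e ≤ 2 * d ^ e
[1+d]^e≤2*d^e d e 2e≤ = *-cancelʳ-≤ p (2 * r) (suc d) (+-cancelʳ-≤ (p * suc d) _ _ (begin
  p * suc d + p * suc d                         ≤⟨ +-mono-≤ (bernoulli′ d e) (bernoulli′ d e) ⟩
  r * suc d + e * p + (r * suc d + e * p)       ≡⟨ shuffle d e p r ⟩
  2 * r * suc d + p * (e + e)                   ≤⟨ +-monoʳ-≤ (2 * r * suc d) (*-monoʳ-≤ p 2e≤) ⟩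
  2 * r * suc d + p * suc d                     ∎))
  where
  open ≤-Reasoning
  p = suc d ^ e
  r = d ^ e
  shuffle : ∀ d e p r → r * suc d + e * p + (r * suc d + e * p) ≡ 2 * r * suc d + p * (e + e)
  shuffle = solve-∀

-- Each half of the exponent d is at most (d + 1) / 2 and costs a factor 2.
[1+d]^d≤4*d^d : ∀ d → suc d ^ d ≤ 4 * d ^ d
[1+d]^d≤4*d^d d = begin
  suc d ^ d                            ≡⟨ cong (suc d ^_) (⌊n/2⌋+⌈n/2⌉≡n d) ⟨
  suc d ^ (f + c)                      ≡⟨ ^-distribˡ-+-* (suc d) f c ⟩
  suc d ^ f * suc d ^ c                ≤⟨ *-mono-≤ ([1+d]^e≤2*d^e d f f+f≤) ([1+d]^e≤2*d^e d c c+c≤) ⟩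
  2 * d ^ f * (2 * d ^ c)              ≡⟨ shuffle (d ^ f) (d ^ c) ⟩
  4 * (d ^ f * d ^ c)                  ≡⟨ cong (4 *_) (^-distribˡ-+-* d f c) ⟨
  4 * d ^ (f + c)                      ≡⟨ cong (λ k → 4 * d ^ k) (⌊n/2⌋+⌈n/2⌉≡n d) ⟩
  4 * d ^ d                            ∎
  where
  open ≤-Reasoning
  f = ⌊ d /2⌋
  c = ⌈ d /2⌉
  shuffle : ∀ a b → 2 * a * (2 * b) ≡ 4 * (a * b)
  shuffle = solve-∀
  f+f≤ : f + f ≤ suc d
  f+f≤ = ≤-trans (+-monoʳ-≤ f (⌊n/2⌋≤⌈n/2⌉ d)) (≤-trans (≤-reflexive (⌊n/2⌋+⌈n/2⌉≡n d)) (n≤1+n d))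
  c+c≤ : c + c ≤ suc d
  c+c≤ = ≤-trans (+-monoʳ-≤ c (⌊n/2⌋≤⌈n/2⌉ (suc d))) (≤-reflexive (⌊n/2⌋+⌈n/2⌉≡n (suc d)))

-- As (1 + 1/d)^d ≥ 2, the exponent d l already gives 2^l ≥ d; further factors only help.
d*d^e≤[1+d]^e : ∀ d l e .{{_ : NonZero d}} → d ≤ 2 ^ l → d * l ≤ e → d * d ^ e ≤ suc d ^ e
d*d^e≤[1+d]^e d l e d≤2^l dl≤e = begin
  d * d ^ e                           ≡⟨ cong (λ k → d * d ^ k) (m+[n∸m]≡n dl≤e) ⟨
  d * d ^ (d * l + r)                 ≡⟨ cong (d *_) (^-distribˡ-+-* d (d * l) r) ⟩
  d * (d ^ (d * l) * d ^ r)           ≡⟨ *-assoc d (d ^ (d * l)) (d ^ r) ⟨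
  d * d ^ (d * l) * d ^ r             ≤⟨ *-mono-≤ main (^-monoˡ-≤ r (n≤1+n d)) ⟩
  suc d ^ (d * l) * suc d ^ r         ≡⟨ ^-distribˡ-+-* (suc d) (d * l) r ⟨
  suc d ^ (d * l + r)                 ≡⟨ cong (suc d ^_) (m+[n∸m]≡n dl≤e) ⟩
  suc d ^ e                           ∎
  where
  open ≤-Reasoning
  r = e ∸ d * l
  main : d * d ^ (d * l) ≤ suc d ^ (d * l)
  main = begin
    d * d ^ (d * l)          ≤⟨ *-monoˡ-≤ (d ^ (d * l)) d≤2^l ⟩
    2 ^ l * d ^ (d * l)      ≡⟨ cong (2 ^ l *_) (^-*-assoc d d l) ⟨
    2 ^ l * (d ^ d) ^ l      ≡⟨ ^-distribʳ-* l 2 (d ^ d) ⟨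
    (2 * d ^ d) ^ l          ≤⟨ ^-monoˡ-≤ l (2*d^d≤[1+d]^d d) ⟩
    (suc d ^ d) ^ l          ≡⟨ ^-*-assoc (suc d) d l ⟩
    suc d ^ (d * l)          ∎

cube≤2^ : ∀ c → (16 + c) ^ 3 ≤ 2 ^ (15 + c)
cube≤2^ zero    = m≤m+n 4096 28672
cube≤2^ (suc c) = begin
  (17 + c) ^ 3                  ≤⟨ m≤m+n _ (3279 + 669 * c + 45 * (c * c) + c * (c * c)) ⟩
  (17 + c) ^ 3 + (3279 + 669 * c + 45 * (c * c) + c * (c * c)) ≡⟨ shuffle c ⟩
  2 * (16 + c) ^ 3              ≤⟨ *-monoʳ-≤ 2 (cube≤2^ c) ⟩
  2 ^ (16 + c)                  ∎
  where
  open ≤-Reasoning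
  -- 2(16+c)³ − (17+c)³, expanded
  shuffle : ∀ c → (17 + c) * ((17 + c) * ((17 + c) * 1)) + (3279 + 669 * c + 45 * (c * c) + c * (c * c)) ≡
                2 * ((16 + c) * ((16 + c) * ((16 + c) * 1)))
  shuffle = solve-∀

-- Growth of the product of the factors 1 + 1/rate

-- num x / den x is the bound ∏ (1 + 1/rate), where scale x = i > 0 means W b^(6+2i) ≤ x < W b^(8+2i)
-- (and scale x = 0 means x < W b^8).
module Growth (b W : ℕ) (16≤b : 16 ≤ b) (1≤W : 1 ≤ W) where

  private instance
    b≢0 : NonZero b
    b≢0 = >-nonZero (≤-trans (s≤s z≤n) 16≤b)

  threshold : ℕ → ℕ
  threshold i = W * b ^ (8 + 2 * i)

  step : (x i : ℕ) → Dec (x < threshold i) → ℕ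
  step x i (yes _) = i
  step x i (no _)  = suc i

  scale : ℕ → ℕ
  scale zero    = 0
  scale (suc x) = step (suc x) (scale x) (suc x <? threshold (scale x))

  -- At scale i + 1 this is ρ^(3/2) for ρ = b^(8 + 2 i). Scale i has at most `threshold i` values x,
  -- so it adds at most W / b^(1 + i) to the sum of 1/rate: a geometric series of order W / b.
  rate : ℕ → ℕ
  rate x = b ^ (9 + 3 * scale x)

  num den : ℕ → ℕ
  num zero    = 1
  num (suc x) = suc (rate (suc x)) * num x
  den zero    = 1
  den (suc x) = rate (suc x) * den x

  threshold-suc : ∀ i → threshold (suc i) ≡ b * b * threshold i
  threshold-suc i = trans (cong (λ k → W * b ^ (8 + k)) (*-suc 2 i)) (shuffle W b (b ^ (8 + 2 * i)))
    where
    shuffle : ∀ W b p → W * (b * (b * p)) ≡ b * b * (W * p)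
    shuffle = solve-∀

  threshold-≤ : ∀ i → 2 * threshold i ≤ threshold (suc i)
  threshold-≤ i = ≤-trans (*-monoˡ-≤ (threshold i) (*-mono-≤ {2} {b} {1} {b} (≤-trans (m≤m+n 2 14) 16≤b) (≤-trans (m≤m+n 1 15) 16≤b)))
    (≤-reflexive (sym (threshold-suc i)))

  threshold>0 : ∀ i → 0 < threshold i
  threshold>0 i = *-mono-≤ 1≤W (m^n>0 b (8 + 2 * i))

  -- A single increment of the scale suffices: x grows by 1 while the threshold at least doubles.
  scale-upper : ∀ x → x < threshold (scale x)
  scale-upper zero = threshold>0 0
  scale-upper (suc x) with suc x <? threshold (scale x)
  ... | yes x< = x<
  ... | no _   = begin-strict
    suc x                       ≤⟨ scale-upper x ⟩
    threshold i                 <⟨ m<m+n (threshold i) (threshold>0 i) ⟩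
    threshold i + threshold i   ≡⟨ cong (threshold i +_) (+-identityʳ _) ⟨
    2 * threshold i             ≤⟨ threshold-≤ i ⟩
    threshold (suc i)           ∎
    where
    open ≤-Reasoning
    i = scale x

  scale-lower : ∀ x {i} → scale x ≡ suc i → threshold i ≤ x
  scale-lower (suc x) e with suc x <? threshold (scale x)
  scale-lower (suc x) e    | yes _ = m≤n⇒m≤1+n (scale-lower x e)
  scale-lower (suc x) refl | no x≮ = ≮⇒≥ x≮

  scale-suc : ∀ x → scale x ≤ scale (suc x)
  scale-suc x with suc x <? threshold (scale x)
  ... | yes _ = ≤-refl
  ... | no _  = n≤1+n (scale x)

  rate-mono : ∀ x z → rate x ≤ rate (x + z)
  rate-mono x zero    = ≤-reflexive (cong rate (sym (+-identityʳ x)))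
  rate-mono x (suc z) = ≤-trans (rate-mono x z) (≤-trans
    (^-monoʳ-≤ b (+-monoʳ-≤ 9 (*-monoʳ-≤ 3 (scale-suc (x + z)))))
    (≤-reflexive (cong rate (sym (+-suc x z)))))

  den>0 : ∀ x → 0 < den x
  den>0 zero    = s≤s z≤n
  den>0 (suc x) = *-mono-≤ (m^n>0 b (9 + 3 * scale (suc x))) (den>0 x)

  -- A rate of at most d makes 1 + 1/rate at least 1 + 1/d, and there are e such factors between z
  -- and z + e.
  ratio : ∀ z e d → (∀ i → i < e → rate (suc (z + i)) ≤ d) →
          num z * den (z + e) * suc d ^ e ≤ num (z + e) * den z * d ^ e
  ratio z zero    d rates≤ rewrite +-identityʳ z = ≤-refl
  ratio z (suc e) d rates≤ rewrite +-suc z e = begin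
    num z * (r * den (z + e)) * (suc d * suc d ^ e)   ≡⟨ shuffle₁ (num z) r (den (z + e)) d (suc d ^ e) ⟩
    r * suc d * (num z * den (z + e) * suc d ^ e)     ≤⟨ *-mono-≤ r*≤ (ratio z e d λ i i<e → rates≤ i (m≤n⇒m≤1+n i<e)) ⟩
    suc r * d * (num (z + e) * den z * d ^ e)         ≡⟨ shuffle₂ (num (z + e)) r (den z) d (d ^ e) ⟩
    suc r * num (z + e) * den z * (d * d ^ e)         ∎
    where
    open ≤-Reasoning
    r = rate (suc (z + e))
    r*≤ : r * suc d ≤ suc r * d
    r*≤ = ≤-trans (≤-reflexive (*-suc r d)) (+-monoˡ-≤ (r * d) (rates≤ e ≤-refl))
    shuffle₁ : ∀ n r q d p → n * (r * q) * (suc d * p) ≡ r * suc d * (n * q * p)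
    shuffle₁ = solve-∀
    shuffle₂ : ∀ n r q d p → suc r * d * (n * q * p) ≡ suc r * n * q * (d * p)
    shuffle₂ = solve-∀

  -- With c = b^(4+i), the rate is c³, the ρ² removed points number c⁴, and (1 + 1/c³)^(c⁴−1) ≥ c³.
  jump : ∀ y z {i} → scale (suc y) ≡ suc i → z + b ^ (8 + 2 * i) * b ^ (8 + 2 * i) ≤ suc y →
         num z * den y * rate (suc y) ≤ num y * den z
  jump y z {i} sc z+ρ²≤ = *-cancelʳ-≤ _ _ (suc d ^ e) {{m^n≢0 (suc d) e}} (begin
    num z * den y * d * suc d ^ e              ≡⟨ shuffle₁ (num z * den y) d (suc d ^ e) ⟩
    d * (num z * den y * suc d ^ e)            ≡⟨ cong (λ k → d * (num z * den k * suc d ^ e)) z+e≡y ⟨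
    d * (num z * den (z + e) * suc d ^ e)      ≤⟨ *-monoʳ-≤ d (ratio z e d rates≤) ⟩
    d * (num (z + e) * den z * d ^ e)          ≡⟨ cong (λ k → d * (num k * den z * d ^ e)) z+e≡y ⟩
    d * (num y * den z * d ^ e)                ≡⟨ shuffle₂ d (num y * den z) (d ^ e) ⟩
    num y * den z * (d * d ^ e)                ≤⟨ *-monoʳ-≤ (num y * den z) (d*d^e≤[1+d]^e d (c ∸ 1) e {{d≢0}} d≤2^ d*≤e) ⟩
    num y * den z * suc d ^ e                  ∎)
    where
    open ≤-Reasoning
    d = rate (suc y)
    e = y ∸ z
    c = b ^ (4 + i)
    ρ² = b ^ (8 + 2 * i) * b ^ (8 + 2 * i)
    d≢0 : NonZero d
    d≢0 = m^n≢0 b (9 + 3 * scale (suc y))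
    d≡c³ : d ≡ c ^ 3
    d≡c³ = trans (cong (λ k → b ^ (9 + 3 * k)) sc) (trans (cong (b ^_) (shuffle i)) (sym (^-*-assoc b (4 + i) 3)))
      where
      shuffle : ∀ i → 9 + 3 * suc i ≡ (4 + i) * 3
      shuffle = solve-∀
    ρ²≡d*c : ρ² ≡ d * c
    ρ²≡d*c = trans (sym (^-distribˡ-+-* b (8 + 2 * i) (8 + 2 * i)))
      (trans (cong (b ^_) (shuffle i)) (trans (^-distribˡ-+-* b ((4 + i) * 3) (4 + i))
        (cong (_* c) (trans (sym (^-*-assoc b (4 + i) 3)) (sym d≡c³)))))
      where
      shuffle : ∀ i → 8 + 2 * i + (8 + 2 * i) ≡ (4 + i) * 3 + (4 + i)
      shuffle = solve-∀
    16≤c : 16 ≤ c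
    16≤c = ≤-trans 16≤b (≤-trans (≤-reflexive (sym (*-identityʳ b))) (*-monoʳ-≤ b (m^n>0 b (3 + i))))
    d≤2^ : d ≤ 2 ^ (c ∸ 1)
    d≤2^ = begin
      d                          ≡⟨ d≡c³ ⟩
      c ^ 3                      ≡⟨ cong (_^ 3) (m+[n∸m]≡n 16≤c) ⟨
      (16 + (c ∸ 16)) ^ 3        ≤⟨ cube≤2^ (c ∸ 16) ⟩
      2 ^ (15 + (c ∸ 16))        ≡⟨ cong (λ k → 2 ^ (k ∸ 1)) (m+[n∸m]≡n 16≤c) ⟩
      2 ^ (c ∸ 1)                ∎
    -- One of the ρ² points is v itself, already missing from y. The other ρ² - 1 = c⁴ - 1 suffice,
    -- since d (c - 1) = c⁴ - c³.
    d*[c∸1]<ρ² : suc (d * (c ∸ 1)) ≤ ρ²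
    d*[c∸1]<ρ² = begin
      suc (d * (c ∸ 1))          ≤⟨ +-monoˡ-≤ (d * (c ∸ 1)) (m^n>0 b (9 + 3 * scale (suc y))) ⟩
      d + d * (c ∸ 1)            ≡⟨ *-suc d (c ∸ 1) ⟨
      d * suc (c ∸ 1)            ≡⟨ cong (d *_) (m+[n∸m]≡n (≤-trans (s≤s z≤n) 16≤c)) ⟩
      d * c                      ≡⟨ ρ²≡d*c ⟨
      ρ²                         ∎
    z+d*≤y : z + d * (c ∸ 1) ≤ y
    z+d*≤y = +-cancelˡ-≤ 1 _ _ (≤-trans (≤-reflexive (sym (+-suc z _)))
      (≤-trans (+-monoʳ-≤ z d*[c∸1]<ρ²) z+ρ²≤))
    z+e≡y : z + e ≡ y
    z+e≡y = m+[n∸m]≡n (≤-trans (m≤m+n z _) z+d*≤y)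
    d*≤e : d * (c ∸ 1) ≤ e
    d*≤e = +-cancelˡ-≤ z _ _ (≤-trans z+d*≤y (≤-reflexive (sym z+e≡y)))
    rates≤ : ∀ i → i < e → rate (suc (z + i)) ≤ d
    rates≤ i i<e = subst (λ k → rate (suc (z + i)) ≤ rate k)
      (cong suc (trans (+-assoc z i (e ∸ i)) (trans (cong (z +_) (m+[n∸m]≡n (<⇒≤ i<e))) z+e≡y)))
      (rate-mono (suc (z + i)) (e ∸ i))
    shuffle₁ : ∀ a b c → a * b * c ≡ b * (a * c)
    shuffle₁ = solve-∀
    shuffle₂ : ∀ a b c → a * (b * c) ≡ b * (a * c)
    shuffle₂ = solve-∀

  -- The initial exponent 2 W b^8 of `potential`, multiplied by b³ at each change of scale, when
  -- that inequality is raised to the power b³ to follow `rate`.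
  budget : ℕ → ℕ
  budget i = 2 * (W * b ^ (8 + 3 * i))

  budget-suc : ∀ i → budget i * b ^ 3 ≡ budget (suc i)
  budget-suc i = trans (shuffle W (b ^ (8 + 3 * i)) b) (cong (λ k → 2 * (W * b ^ (8 + k))) (sym (*-suc 3 i)))
    where
    shuffle : ∀ W p b → 2 * (W * p) * (b * (b * (b * 1))) ≡ 2 * (W * (b * (b * (b * p))))
    shuffle = solve-∀

  -- The exponents stand for the differences n - m ≤ q - p. A new factor 1 + 1/r under the power r
  -- costs one 4, hence `suc q`.
  factor : ∀ r u v {m n p q} → u ^ r * 4 ^ m ≤ v ^ r * 4 ^ n → n + p ≤ m + q →
           (suc r * u) ^ r * 4 ^ p ≤ (r * v) ^ r * 4 ^ suc q
  factor r u v {m} {n} {p} {q} h n+p≤m+q = *-cancelʳ-≤ _ _ (4 ^ m) {{m^n≢0 4 m}} (begin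
    (suc r * u) ^ r * 4 ^ p * 4 ^ m                 ≡⟨ cong (λ k → k * 4 ^ p * 4 ^ m) (^-distribʳ-* r (suc r) u) ⟩
    suc r ^ r * u ^ r * 4 ^ p * 4 ^ m               ≡⟨ shuffle₁ (suc r ^ r) (u ^ r) (4 ^ p) (4 ^ m) ⟩
    suc r ^ r * 4 ^ p * (u ^ r * 4 ^ m)             ≤⟨ *-mono-≤ (*-monoˡ-≤ (4 ^ p) ([1+d]^d≤4*d^d r)) h ⟩
    4 * r ^ r * 4 ^ p * (v ^ r * 4 ^ n)             ≡⟨ shuffle₂ (r ^ r) (4 ^ p) (v ^ r) (4 ^ n) ⟩
    4 * (r ^ r * v ^ r) * (4 ^ n * 4 ^ p)           ≡⟨ cong₂ (λ k l → 4 * k * l) (^-distribʳ-* r r v) (^-distribˡ-+-* 4 n p) ⟨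
    4 * (r * v) ^ r * 4 ^ (n + p)                   ≤⟨ *-monoʳ-≤ (4 * (r * v) ^ r) (^-monoʳ-≤ 4 n+p≤m+q) ⟩
    4 * (r * v) ^ r * 4 ^ (m + q)                   ≡⟨ cong (4 * (r * v) ^ r *_) (^-distribˡ-+-* 4 m q) ⟩
    4 * (r * v) ^ r * (4 ^ m * 4 ^ q)               ≡⟨ shuffle₃ ((r * v) ^ r) (4 ^ m) (4 ^ q) ⟩
    (r * v) ^ r * 4 ^ suc q * 4 ^ m                 ∎)
    where
    open ≤-Reasoning
    shuffle₁ : ∀ a b c d → a * b * c * d ≡ a * c * (b * d)
    shuffle₁ = solve-∀
    shuffle₂ : ∀ a b c d → 4 * a * b * (c * d) ≡ 4 * (a * c) * (d * b)
    shuffle₂ = solve-∀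
    shuffle₃ : ∀ a b c → 4 * a * (b * c) ≡ a * (4 * c) * b
    shuffle₃ = solve-∀

  raise : ∀ e u v r m n → u ^ r * 4 ^ m ≤ v ^ r * 4 ^ n → u ^ (r * e) * 4 ^ (m * e) ≤ v ^ (r * e) * 4 ^ (n * e)
  raise e u v r m n h = subst₂ _≤_ (expand u r m) (expand v r n) (^-monoˡ-≤ e h)
    where
    expand : ∀ u r m → (u ^ r * 4 ^ m) ^ e ≡ u ^ (r * e) * 4 ^ (m * e)
    expand u r m = trans (^-distribʳ-* e (u ^ r) (4 ^ m)) (cong₂ _*_ (^-*-assoc u r e) (^-*-assoc 4 m e))

  -- The left exponent 2 * threshold absorbs the loss b³ x incurred when the scale increases at x = threshold.
  potential : ∀ x → num x ^ rate x * 4 ^ (2 * threshold (scale x)) ≤ den x ^ rate x * 4 ^ (x + budget (scale x))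
  potential zero = ≤-refl
  potential (suc x) with suc x <? threshold (scale x)
  ... | yes _ = factor (b ^ (9 + 3 * scale x)) (num x) (den x)
    {m = 2 * threshold (scale x)} {n = x + budget (scale x)} {p = 2 * threshold (scale x)} {q = x + budget (scale x)}
    (potential x) (≤-reflexive (+-comm (x + budget (scale x)) (2 * threshold (scale x))))
  ... | no _  = factor r (num x) (den x) {m = 2 * V * b ^ 3} {n = (x + budget i) * b ^ 3} {p = 2 * threshold (suc i)} {q = x + budget (suc i)}
    (subst (λ r → num x ^ r * 4 ^ (2 * V * b ^ 3) ≤ den x ^ r * 4 ^ ((x + budget i) * b ^ 3)) r≡
      (raise (b ^ 3) (num x) (den x) (rate x) (2 * V) (x + budget i) (potential x)))
    (begin
      (x + budget i) * b ^ 3 + 2 * threshold (suc i)         ≡⟨ cong₂ (λ k l → k + 2 * l) (*-distribʳ-+ (b ^ 3) x (budget i)) (threshold-suc i) ⟩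
      x * b ^ 3 + budget i * b ^ 3 + 2 * (b * b * V)         ≡⟨ cong (λ k → x * b ^ 3 + k + 2 * (b * b * V)) (budget-suc i) ⟩
      -- Of the two copies of V b³ available, one covers x b³, as x < V, and the other covers twice
      -- the next threshold.
      x * b ^ 3 + budget (suc i) + 2 * (b * b * V)           ≤⟨ +-mono-≤ (+-monoˡ-≤ (budget (suc i)) (*-monoˡ-≤ (b ^ 3) (<⇒≤ (scale-upper x)))) (begin
        2 * (b * b * V)                                        ≤⟨ *-monoˡ-≤ (b * b * V) (≤-trans (m≤m+n 2 14) 16≤b) ⟩
        b * (b * b * V)                                        ≡⟨ shuffle₁ b V ⟩
        V * b ^ 3                                              ∎) ⟩
      V * b ^ 3 + budget (suc i) + V * b ^ 3                 ≡⟨ shuffle₂ (V * b ^ 3) (budget (suc i)) ⟩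
      2 * (V * b ^ 3) + budget (suc i)                       ≡⟨ cong (_+ budget (suc i)) (*-assoc 2 V (b ^ 3)) ⟨
      2 * V * b ^ 3 + budget (suc i)                         ≤⟨ +-monoʳ-≤ (2 * V * b ^ 3) (m≤n+m (budget (suc i)) x) ⟩
      2 * V * b ^ 3 + (x + budget (suc i))                   ∎)
    where
    open ≤-Reasoning
    i = scale x
    V = threshold i
    r = b ^ (9 + 3 * suc i)
    r≡ : rate x * b ^ 3 ≡ r
    r≡ = trans (sym (^-distribˡ-+-* b (9 + 3 * i) 3)) (cong (b ^_) (shuffle i))
      where
      shuffle : ∀ i → 9 + 3 * i + 3 ≡ 9 + 3 * suc i
      shuffle = solve-∀
    shuffle₁ : ∀ b V → b * (b * b * V) ≡ V * (b * (b * (b * 1)))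
    shuffle₁ = solve-∀
    shuffle₂ : ∀ a c → a + c + a ≡ 2 * a + c
    shuffle₂ = solve-∀

  -- With e = b^(8 + 3 i) the rate is b e and the budget 2 W e, so extracting the root of order e
  -- from `potential` removes the scale.
  num^b≤ : ∀ x → num x ^ b ≤ den x ^ b * 4 ^ (2 * W)
  num^b≤ x = ^-cancelʳ-≤ e {{m^n≢0 b (8 + 3 * i)}} (begin
    (num x ^ b) ^ e                       ≡⟨ ^-*-assoc (num x) b e ⟩
    num x ^ rate x                        ≤⟨ *-cancelʳ-≤ _ _ (4 ^ (2 * V)) {{m^n≢0 4 (2 * V)}} (begin
      num x ^ rate x * 4 ^ (2 * V)          ≤⟨ potential x ⟩
      den x ^ rate x * 4 ^ (x + budget i)   ≤⟨ *-monoʳ-≤ (den x ^ rate x) (^-monoʳ-≤ 4 (+-monoˡ-≤ (budget i)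
                                                 (≤-trans (<⇒≤ (scale-upper x)) (m≤m+n V _)))) ⟩
      den x ^ rate x * 4 ^ (2 * V + budget i) ≡⟨ cong (den x ^ rate x *_) (trans (^-distribˡ-+-* 4 (2 * V) (budget i)) (*-comm (4 ^ (2 * V)) _)) ⟩
      den x ^ rate x * (4 ^ budget i * 4 ^ (2 * V)) ≡⟨ *-assoc (den x ^ rate x) _ _ ⟨
      den x ^ rate x * 4 ^ budget i * 4 ^ (2 * V) ∎) ⟩
    den x ^ rate x * 4 ^ budget i         ≡⟨ cong₂ _*_ (sym (^-*-assoc (den x) b e))
                                               (trans (cong (4 ^_) (sym (*-assoc 2 W e))) (sym (^-*-assoc 4 (2 * W) e))) ⟩
    (den x ^ b) ^ e * (4 ^ (2 * W)) ^ e   ≡⟨ ^-distribʳ-* e (den x ^ b) (4 ^ (2 * W)) ⟨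
    (den x ^ b * 4 ^ (2 * W)) ^ e         ∎)
    where
    open ≤-Reasoning
    i = scale x
    V = threshold i
    e = b ^ (8 + 3 * i)

-- Supersaturation

above : {P : Point t n → Set} → (∀ x → Dec (P x)) → Point t n → ℕ
above P? x = ∑ᵖ (λ z → 𝟙 (P? z) * 𝟙 (x ≼? z))

-- The points above y are also above x, and x itself is not among them.
above-strict : {P : Point t n → Set} (P? : ∀ x → Dec (P x)) {x y : Point t n} →
               P x → x ≼ y → x ≢ y → above P? y < above P? x
above-strict {t} {n} P? {x} {y} px x≼y x≢y = begin
  suc (above P? y)
    ≡⟨ cong (_+ above P? y) (∑-δ _≟ᵖ_ (λ _ → 1) (allPoints-unique t n) (∈-allPoints x)) ⟨
  ∑ᵖ (λ z → 𝟙 (z ≟ᵖ x) * 1) + above P? y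
    ≡⟨ ∑-+ (allPoints t n) _ _ ⟨
  ∑ᵖ (λ z → 𝟙 (z ≟ᵖ x) * 1 + 𝟙 (P? z) * 𝟙 (y ≼? z))
    ≤⟨ ∑-mono (allPoints t n) compare ⟩
  above P? x ∎
  where
  open ≤-Reasoning
  compare : ∀ z → 𝟙 (z ≟ᵖ x) * 1 + 𝟙 (P? z) * 𝟙 (y ≼? z) ≤ 𝟙 (P? z) * 𝟙 (x ≼? z)
  compare z with z ≟ᵖ x
  ... | no _ = *-monoʳ-≤ (𝟙 (P? z)) (𝟙-mono (y ≼? z) (x ≼? z) (≼-trans x≼y))
  ... | yes refl = ≤-reflexive (trans
    (cong (λ k → 1 + 𝟙 (P? x) * k) (𝟙-false (y ≼? x) (λ y≼x → x≢y (≼-antisym x≼y y≼x))))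
    (trans (cong suc (*-zeroʳ (𝟙 (P? x)))) (sym (cong₂ _*_ (𝟙-true (P? x) px) (𝟙-true (x ≼? x) ≼-refl)))))

-- The points of P with a prescribed number of points of P above them form an antichain.
few-above : {P : Point t n → Set} (P? : ∀ x → Dec (P x)) (ρ : ℕ) →
            ∑ᵖ (λ x → 𝟙 (P? x ×-dec (above P? x <? ρ))) ≤ ρ * α t n
few-above {t} {n} P? ρ = begin
  ∑ᵖ (λ x → 𝟙 (P? x ×-dec (above P? x <? ρ)))
    ≤⟨ ∑-mono (allPoints t n) (λ x → 𝟙-elim (P? x ×-dec (above P? x <? ρ)) λ (px , u<ρ) → ≤-trans
         (≤-reflexive (sym (𝟙-true (P? x ×-dec (above P? x ≟ above P? x)) (px , refl))))
         (∑-member (λ c → 𝟙 (P? x ×-dec (above P? x ≟ c))) (∈-upTo⁺ u<ρ))) ⟩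
  ∑ᵖ (λ x → ∑< ρ (λ c → 𝟙 (P? x ×-dec (above P? x ≟ c))))
    ≡⟨ ∑-swap (allPoints t n) (upTo ρ) _ ⟩
  ∑< ρ (λ c → ∑ᵖ (λ x → 𝟙 (P? x ×-dec (above P? x ≟ c))))
    ≤⟨ ∑-mono (upTo ρ) (λ c → antichain-size≤α (λ x → P? x ×-dec (above P? x ≟ c)) (antichain c)) ⟩
  ∑< ρ (λ _ → α t n)
    ≡⟨ trans (∑-const (upTo ρ) (α t n)) (cong (_* α t n) (length-upTo ρ)) ⟩
  ρ * α t n ∎
  where
  open ≤-Reasoning
  antichain : ∀ c {x y} → (_ × above P? x ≡ c) → (_ × above P? y ≡ c) → x ≼ y → x ≡ y
  antichain c {x} {y} (px , ux) (_ , uy) x≼y with x ≟ᵖ y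
  ... | yes x≡y = x≡y
  ... | no x≢y  = contradiction (trans uy (sym ux)) (<⇒≢ (above-strict P? px x≼y x≢y))

module _ {t a b : ℕ} {X : Point t (a + b) → Set} (X? : ∀ z → Dec (X z)) (ρ : ℕ) where

  private
    above₂ : Point t a → Point t b → ℕ
    above₂ x = above (λ y → X? (x ++ᵛ y))

    -- Two nested prunings: the first asks for ρ members of X above in the slice with x fixed, the
    -- second for ρ survivors of the first above in the slice with y fixed. The nesting makes the
    -- two counts multiply.
    X₂? : ∀ x y → Dec (X (x ++ᵛ y) × ρ ≤ above₂ x y)
    X₂? x y = X? (x ++ᵛ y) ×-dec (ρ ≤? above₂ x y)

    above₁ : Point t a → Point t b → ℕ
    above₁ x y = above (λ x → X₂? x y) x

    X₁? : ∀ x y → Dec ((X (x ++ᵛ y) × ρ ≤ above₂ x y) × ρ ≤ above₁ x y)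
    X₁? x y = X₂? x y ×-dec (ρ ≤? above₁ x y)

    split : ∀ {P : Set} (p : Dec P) u → 𝟙 p ≤ 𝟙 (p ×-dec (u <? ρ)) + 𝟙 (p ×-dec (ρ ≤? u))
    split p u = 𝟙-elim p λ h → [ (λ ρ≤u → ≤-trans (one (p ×-dec (ρ ≤? u)) (h , ρ≤u)) (m≤n+m _ (𝟙 (p ×-dec (u <? ρ)))))
                               , (λ u<ρ → ≤-trans (one (p ×-dec (u <? ρ)) (h , u<ρ)) (m≤m+n _ _)) ]′ (≤-<-connex ρ u)
      where
      one : ∀ {P : Set} (d : Dec P) → P → 1 ≤ 𝟙 d
      one d h = ≤-reflexive (sym (𝟙-true d h))

  -- By `few-above` the first pruning loses at most ρ α(t,b) in each of t^a slices and the second at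
  -- most ρ α(t,a) in each of t^b, so some point survives both.
  supersaturation : ρ * (α t a * t ^ b + α t b * t ^ a) < ∑ᵖ (λ z → 𝟙 (X? z)) →
                    ∃ λ v → X v × ρ * ρ ≤ ∑ᵖ (λ z → 𝟙 (X? z) * 𝟙 (v ≼? z))
  supersaturation large =
    let x , _ , pos-x = ∑-positive (allPoints t a) _ pos
        y , _ , pos-y = ∑-positive (allPoints t b) _ pos-x
        (Xxy , _) , ρ≤above₁ = 𝟙-positive (X₁? x y) pos-y
    in x ++ᵛ y , Xxy , many-above x y ρ≤above₁
    where
    open ≤-Reasoning
    S₂ S₁ : ℕ
    S₂ = ∑ᵖ {t} {a} (λ x → ∑ᵖ {t} {b} (λ y → 𝟙 (X₂? x y)))
    S₁ = ∑ᵖ {t} {a} (λ x → ∑ᵖ {t} {b} (λ y → 𝟙 (X₁? x y)))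
    lose₂ : ∑ᵖ (λ z → 𝟙 (X? z)) ≤ ρ * (α t b * t ^ a) + S₂
    lose₂ = begin
      ∑ᵖ (λ z → 𝟙 (X? z))
        ≡⟨ ∑ᵖ-++ {t} {b} a _ ⟩
      ∑ᵖ {t} {a} (λ x → ∑ᵖ {t} {b} (λ y → 𝟙 (X? (x ++ᵛ y))))
        ≤⟨ ∑-mono (allPoints t a) (λ x → begin
             ∑ᵖ {t} {b} (λ y → 𝟙 (X? (x ++ᵛ y)))
               ≤⟨ ∑-mono (allPoints t b) (λ y → split (X? (x ++ᵛ y)) (above₂ x y)) ⟩
             ∑ᵖ {t} {b} (λ y → 𝟙 (X? (x ++ᵛ y) ×-dec (above₂ x y <? ρ)) + 𝟙 (X₂? x y))
               ≡⟨ ∑-+ (allPoints t b) _ _ ⟩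
             ∑ᵖ {t} {b} (λ y → 𝟙 (X? (x ++ᵛ y) ×-dec (above₂ x y <? ρ))) + ∑ᵖ {t} {b} (λ y → 𝟙 (X₂? x y))
               ≤⟨ +-monoˡ-≤ _ (few-above (λ y → X? (x ++ᵛ y)) ρ) ⟩
             ρ * α t b + ∑ᵖ {t} {b} (λ y → 𝟙 (X₂? x y)) ∎) ⟩
      ∑ᵖ {t} {a} (λ x → ρ * α t b + ∑ᵖ {t} {b} (λ y → 𝟙 (X₂? x y)))
        ≡⟨ ∑-+ (allPoints t a) _ _ ⟩
      ∑ᵖ {t} {a} (λ x → ρ * α t b) + S₂
        ≡⟨ cong (_+ S₂) (trans (∑ᵖ-const {t} {a} (ρ * α t b)) (shuffle (t ^ a) ρ (α t b))) ⟩
      ρ * (α t b * t ^ a) + S₂ ∎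
      where
      shuffle : ∀ p r c → p * (r * c) ≡ r * (c * p)
      shuffle = solve-∀
    lose₁ : S₂ ≤ ρ * (α t a * t ^ b) + S₁
    lose₁ = begin
      S₂
        ≡⟨ ∑-swap (allPoints t a) (allPoints t b) _ ⟩
      ∑ᵖ {t} {b} (λ y → ∑ᵖ {t} {a} (λ x → 𝟙 (X₂? x y)))
        ≤⟨ ∑-mono (allPoints t b) (λ y → begin
             ∑ᵖ {t} {a} (λ x → 𝟙 (X₂? x y))
               ≤⟨ ∑-mono (allPoints t a) (λ x → split (X₂? x y) (above₁ x y)) ⟩
             ∑ᵖ {t} {a} (λ x → 𝟙 (X₂? x y ×-dec (above₁ x y <? ρ)) + 𝟙 (X₁? x y))
               ≡⟨ ∑-+ (allPoints t a) _ _ ⟩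
             ∑ᵖ {t} {a} (λ x → 𝟙 (X₂? x y ×-dec (above₁ x y <? ρ))) + ∑ᵖ {t} {a} (λ x → 𝟙 (X₁? x y))
               ≤⟨ +-monoˡ-≤ _ (few-above (λ x → X₂? x y) ρ) ⟩
             ρ * α t a + ∑ᵖ {t} {a} (λ x → 𝟙 (X₁? x y)) ∎) ⟩
      ∑ᵖ {t} {b} (λ y → ρ * α t a + ∑ᵖ {t} {a} (λ x → 𝟙 (X₁? x y)))
        ≡⟨ ∑-+ (allPoints t b) _ _ ⟩
      ∑ᵖ {t} {b} (λ y → ρ * α t a) + ∑ᵖ {t} {b} (λ y → ∑ᵖ {t} {a} (λ x → 𝟙 (X₁? x y)))
        ≡⟨ cong₂ _+_ (trans (∑ᵖ-const {t} {b} (ρ * α t a)) (shuffle (t ^ b) ρ (α t a)))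
             (∑-swap (allPoints t b) (allPoints t a) _) ⟩
      ρ * (α t a * t ^ b) + S₁ ∎
      where
      shuffle : ∀ p r c → p * (r * c) ≡ r * (c * p)
      shuffle = solve-∀
    pos : 0 < S₁
    pos = +-cancelˡ-< (ρ * (α t a * t ^ b + α t b * t ^ a)) 0 S₁ (begin-strict
      ρ * (α t a * t ^ b + α t b * t ^ a) + 0                  ≡⟨ +-identityʳ _ ⟩
      ρ * (α t a * t ^ b + α t b * t ^ a)                      <⟨ large ⟩
      ∑ᵖ (λ z → 𝟙 (X? z))                                      ≤⟨ ≤-trans lose₂ (+-monoʳ-≤ (ρ * (α t b * t ^ a)) lose₁) ⟩
      ρ * (α t b * t ^ a) + (ρ * (α t a * t ^ b) + S₁)         ≡⟨ shuffle ρ (α t b * t ^ a) (α t a * t ^ b) S₁ ⟩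
      ρ * (α t a * t ^ b + α t b * t ^ a) + S₁                 ∎)
      where
      shuffle : ∀ r p q s → r * p + (r * q + s) ≡ r * (q + p) + s
      shuffle = solve-∀
    many-above : ∀ x y → ρ ≤ above₁ x y → ρ * ρ ≤ ∑ᵖ (λ z → 𝟙 (X? z) * 𝟙 ((x ++ᵛ y) ≼? z))
    many-above x y ρ≤ = begin
      ρ * ρ
        ≤⟨ *-monoˡ-≤ ρ ρ≤ ⟩
      above₁ x y * ρ
        ≡⟨ ∑-*ʳ ρ (allPoints t a) _ ⟨
      ∑ᵖ {t} {a} (λ x′ → 𝟙 (X₂? x′ y) * 𝟙 (x ≼? x′) * ρ)
        ≤⟨ ∑-mono (allPoints t a) row ⟩
      ∑ᵖ {t} {a} (λ x′ → ∑ᵖ {t} {b} (λ y′ → 𝟙 (X? (x′ ++ᵛ y′)) * 𝟙 ((x ++ᵛ y) ≼? (x′ ++ᵛ y′))))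
        ≡⟨ ∑ᵖ-++ {t} {b} a _ ⟨
      ∑ᵖ (λ z → 𝟙 (X? z) * 𝟙 ((x ++ᵛ y) ≼? z)) ∎
      where
      row : ∀ x′ → 𝟙 (X₂? x′ y) * 𝟙 (x ≼? x′) * ρ ≤
                   ∑ᵖ {t} {b} (λ y′ → 𝟙 (X? (x′ ++ᵛ y′)) * 𝟙 ((x ++ᵛ y) ≼? (x′ ++ᵛ y′)))
      row x′ with X₂? x′ y | x ≼? x′
      ... | no _         | _        = z≤n
      ... | yes _        | no _     = z≤n
      ... | yes (_ , ρ≤) | yes x≼x′ = ≤-trans (≤-reflexive (+-identityʳ ρ)) (≤-trans ρ≤
        (∑-mono (allPoints t b) λ y′ → *-monoʳ-≤ (𝟙 (X? (x′ ++ᵛ y′)))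
          (𝟙-mono (y ≼? y′) ((x ++ᵛ y) ≼? (x′ ++ᵛ y′)) (PW.++⁺ x≼x′))))

supersaturation-list : ∀ {t} a b ρ {X : List (Point t (a + b))} → Unique X →
  ρ * (α t a * t ^ b + α t b * t ^ a) < length X → ∃ λ v → v ∈ X × ρ * ρ ≤ length (filter (v ≼?_) X)
supersaturation-list {t} a b ρ {X} u large =
  let v , v∈X , ρ²≤ = supersaturation {t} {a} {b} (_∈ᵖ? X) ρ (<-≤-trans large (≤-reflexive (length≡∑ᵖ u)))
  in v , v∈X , ≤-trans ρ²≤ (≤-reflexive (trans
       (∑-subset _≟ᵖ_ X (λ z → 𝟙 (v ≼? z)) (allPoints-unique t (a + b)) u (λ {x} _ → ∈-allPoints x))
       (sym (length-filter-∑ (v ≼?_) X))))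

-- Counting small antichains inside a list

∑-sublists-∷ : {A : Set} (x : A) (X : List A) (φ : List A → ℕ) →
               ∑ (sublists (x ∷ X)) φ ≡ ∑ (sublists X) (φ ∘ (x ∷_)) + ∑ (sublists X) φ
∑-sublists-∷ x X φ = trans (∑-++ (map (x ∷_) (sublists X)) (sublists X) φ)
  (cong (_+ ∑ (sublists X) φ) (∑-map (x ∷_) (sublists X) φ))

-- The vertex to branch on may sit anywhere in the list; this allows moving it to the front, where
-- `sublists` branches.
∑-sublists-↭ : {A : Set} {X Y : List A} (φ : List A → ℕ) → (∀ {U V} → U ↭ V → φ U ≡ φ V) → X ↭ Y →
               ∑ (sublists X) φ ≡ ∑ (sublists Y) φ
∑-sublists-↭ φ resp P.refl = refl
∑-sublists-↭ φ resp (prep {X} {Y} x p) = trans (∑-sublists-∷ x X φ)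
  (trans (cong₂ _+_ (∑-sublists-↭ (φ ∘ (x ∷_)) (resp ∘ prep x) p) (∑-sublists-↭ φ resp p))
    (sym (∑-sublists-∷ x Y φ)))
∑-sublists-↭ φ resp (swap {X} {Y} x y p) = trans (expand x y X) (trans
  (trans (cong₂ _+_
      (cong₂ _+_
        (trans (∑-cong (sublists X) λ U → resp (swap x y P.refl)) (∑-sublists-↭ (φ ∘ (y ∷_) ∘ (x ∷_)) (resp ∘ prep y ∘ prep x) p))
        (∑-sublists-↭ (φ ∘ (x ∷_)) (resp ∘ prep x) p))
      (cong₂ _+_ (∑-sublists-↭ (φ ∘ (y ∷_)) (resp ∘ prep y) p) (∑-sublists-↭ φ resp p)))
    (+-interchange (∑ (sublists Y) (φ ∘ (y ∷_) ∘ (x ∷_))) (∑ (sublists Y) (φ ∘ (x ∷_))) (∑ (sublists Y) (φ ∘ (y ∷_))) _))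
  (sym (expand y x Y)))
  where
  expand : ∀ x y X → ∑ (sublists (x ∷ y ∷ X)) φ ≡
    ∑ (sublists X) (φ ∘ (x ∷_) ∘ (y ∷_)) + ∑ (sublists X) (φ ∘ (x ∷_)) + (∑ (sublists X) (φ ∘ (y ∷_)) + ∑ (sublists X) φ)
  expand x y X = trans (∑-sublists-∷ x (y ∷ X) φ)
    (cong₂ _+_ (∑-sublists-∷ y X (φ ∘ (x ∷_))) (∑-sublists-∷ y X φ))
∑-sublists-↭ φ resp (P.trans p q) = trans (∑-sublists-↭ φ resp p) (∑-sublists-↭ φ resp q)

∑-sublists-filter : {A : Set} {P : A → Set} (P? : Decidable P) (X : List A) (φ : List A → ℕ) →
  ∑ (sublists X) (λ U → 𝟙 (All.all? P? U) * φ U) ≡ ∑ (sublists (filter P? X)) φ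
∑-sublists-filter P? [] φ = cong (_+ 0) (+-identityʳ (φ []))
∑-sublists-filter {P = P} P? (x ∷ X) φ = trans (∑-sublists-∷ x X _) (step (P? x))
  where
  all : List _ → ℕ
  all U = 𝟙 (All.all? P? U)
  step : Dec (P x) → ∑ (sublists X) (λ U → all (x ∷ U) * φ (x ∷ U)) + ∑ (sublists X) (λ U → all U * φ U) ≡
         ∑ (sublists (filter P? (x ∷ X))) φ
  step (yes px) rewrite filter-accept P? {xs = X} px = trans (cong₂ _+_
      (trans (∑-cong (sublists X) λ U → cong (_* φ (x ∷ U))
          (𝟙-cong (All.all? P? (x ∷ U)) (All.all? P? U) All.tail (px ∷_)))
        (∑-sublists-filter P? X (φ ∘ (x ∷_))))
      (∑-sublists-filter P? X φ))
    (sym (∑-sublists-∷ x (filter P? X) φ))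
  step (no ¬px) rewrite filter-reject P? {xs = X} ¬px = trans (cong (_+ ∑ (sublists X) (λ U → all U * φ U))
      (trans (∑-cong (sublists X) λ U → cong (_* φ (x ∷ U)) (𝟙-false (All.all? P? (x ∷ U)) (¬px ∘ All.head)))
        (∑-zero (sublists X))))
    (∑-sublists-filter P? X φ)

small? : (m : ℕ) (U : List (Point t n)) → Dec (IsAntichain U × length U ≤ m)
small? m U = isAntichain? U ×-dec (length U ≤? m)

count : List (Point t n) → ℕ → ℕ
count X m = ∑ (sublists X) (λ U → 𝟙 (small? m U))

count-↭ : {X Y : List (Point t n)} (m : ℕ) → X ↭ Y → count X m ≡ count Y m
count-↭ {t} {n} m = ∑-sublists-↭ _ λ {U} {V} p → 𝟙-cong (small? m U) (small? m V) (resp p) (resp (↭-sym p))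
  where
  resp : ∀ {U V} → U ↭ V → IsAntichain U × length U ≤ m → IsAntichain V × length V ≤ m
  resp p (anti , len) = antichain-↭ p anti , ≤-trans (≤-reflexive (sym (Perm.↭-length p))) len
    where
    antichain-↭ : ∀ {U V : List (Point t n)} → U ↭ V → IsAntichain U → IsAntichain V
    antichain-↭ p = SetoidPerm.AllPairs-resp-↭ (setoid _) (λ (h , h′) → h′ , h)
      ((λ { refl h → h }) , (λ { refl h → h })) (↭⇒↭ₛ p)

count-∷-zero : (v : Point t n) (X : List (Point t n)) → count (v ∷ X) 0 ≤ count X 0
count-∷-zero v X = ≤-reflexive (trans (∑-sublists-∷ v X _) (cong (_+ count X 0)
  (trans (∑-cong (sublists X) λ U → 𝟙-false (small? 0 (v ∷ U)) (λ { (_ , ()) })) (∑-zero (sublists X)))))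

-- The other members of an antichain through v are incomparable to v, hence form a sublist of the
-- filtered list.
count-∷ : (v : Point t n) (X : List (Point t n)) (m : ℕ) →
          count (v ∷ X) (suc m) ≤ count X (suc m) + count (filter (incomparable? v) X) m
count-∷ v X m = ≤-trans (≤-reflexive (trans (∑-sublists-∷ v X _) (+-comm _ (count X (suc m)))))
  (+-monoʳ-≤ (count X (suc m)) (≤-trans (∑-mono (sublists X) λ U → 𝟙-elim (small? (suc m) (v ∷ U))
      λ { (i ∷ is , s≤s len) → ≤-reflexive (sym (cong₂ _*_ (𝟙-true (All.all? (incomparable? v) U) i) (𝟙-true (small? m U) (is , len)))) })
    (≤-reflexive (∑-sublists-filter (incomparable? v) X _))))

count-∷′ : (v : Point t n) (X : List (Point t n)) (m : ℕ) → count (v ∷ X) (suc m) ≤ count X (suc m) + count X m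
count-∷′ v X m = ≤-trans (≤-reflexive (trans (∑-sublists-∷ v X _) (+-comm _ (count X (suc m)))))
  (+-monoʳ-≤ (count X (suc m)) (∑-mono (sublists X) λ U → 𝟙-mono (small? (suc m) (v ∷ U)) (small? m U)
    λ { (_ ∷ is , s≤s len) → is , len }))

unique-↭ : {X Y : List (Point t n)} → X ↭ Y → Unique X → Unique Y
unique-↭ p = SetoidPerm.Unique-resp-↭ (setoid _) (↭⇒↭ₛ p)

extract : {A : Set} {v : A} {X : List A} → v ∈ X → ∃ λ X′ → X ↭ v ∷ X′
extract {v = v} v∈X with ∈-∃++ v∈X
... | ys , zs , refl = ys ++ zs , Perm.shift v ys zs

-- No point is both incomparable to v and above v. The list v ∷ X is used because v counts among its
-- own upper bounds.
filter-incomparable : (v : Point t n) (X : List (Point t n)) →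
  length (filter (incomparable? v) X) + length (filter (v ≼?_) (v ∷ X)) ≤ suc (length X)
filter-incomparable v X = begin
  length (filter (incomparable? v) X) + length (filter (v ≼?_) (v ∷ X))
    ≡⟨ cong₂ _+_ (length-filter-∑ (incomparable? v) X) (trans (length-filter-∑ (v ≼?_) (v ∷ X)) (cong (_+ ∑ X (λ x → 𝟙 (v ≼? x))) (𝟙-true (v ≼? v) ≼-refl))) ⟩
  ∑ X (λ x → 𝟙 (incomparable? v x)) + suc (∑ X (λ x → 𝟙 (v ≼? x)))
    ≡⟨ trans (+-suc _ _) (cong suc (sym (∑-+ X _ _))) ⟩
  suc (∑ X (λ x → 𝟙 (incomparable? v x) + 𝟙 (v ≼? x)))
    ≤⟨ s≤s (∑-mono X disjoint) ⟩
  suc (∑ X (λ _ → 1))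
    ≡⟨ cong suc (trans (∑-const X 1) (*-identityʳ _)) ⟩
  suc (length X) ∎
  where
  open ≤-Reasoning
  disjoint : ∀ x → 𝟙 (incomparable? v x) + 𝟙 (v ≼? x) ≤ 1
  disjoint x = 𝟙-disjoint (incomparable? v x) (v ≼? x) proj₁

module Counting {t n : ℕ} (b W : ℕ) (16≤b : 16 ≤ b) (1≤W : 1 ≤ W)
  (saturated : ∀ ρ {X : List (Point t n)} → Unique X → 1 ≤ ρ → W * ρ ≤ length X →
               ∃ λ v → v ∈ X × ρ * ρ ≤ length (filter (v ≼?_) X)) where

  open Growth b W 16≤b 1≤W

  private instance
    b≢0 : NonZero b
    b≢0 = >-nonZero (≤-trans (s≤s z≤n) 16≤b)

  q : ℕ
  q = b ^ 9

  -- One step of the recursion: the branch avoiding v may use the full bound for y, the branch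
  -- through v has to be smaller by the factor `rate (suc y)`.
  combine : ∀ c₁ c₂ y Q → c₁ * den y ≤ Q * num y → c₂ * den y * rate (suc y) ≤ Q * num y →
            (c₁ + c₂) * den (suc y) ≤ Q * num (suc y)
  combine c₁ c₂ y Q h₁ h₂ = begin
    (c₁ + c₂) * (d * den y)                 ≡⟨ shuffle₁ c₁ c₂ d (den y) ⟩
    c₂ * den y * d + d * (c₁ * den y)       ≤⟨ +-mono-≤ h₂ (*-monoʳ-≤ d h₁) ⟩
    Q * num y + d * (Q * num y)             ≡⟨ shuffle₂ Q d (num y) ⟩
    Q * (suc d * num y)                     ∎
    where
    open ≤-Reasoning
    d = rate (suc y)
    shuffle₁ : ∀ a c d p → (a + c) * (d * p) ≡ c * p * d + d * (a * p)
    shuffle₁ = solve-∀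
    shuffle₂ : ∀ Q d p → Q * p + d * (Q * p) ≡ Q * (suc d * p)
    shuffle₂ = solve-∀

  -- Induction on a bound s for the length, since the branch through v continues with a filtered
  -- list, not a subterm.
  count≤ : ∀ s {X : List (Point t n)} m → length X ≤ s → Unique X →
           count X m * den (length X) ≤ q ^ m * num (length X)
  count≤ s {[]} m _ _ = subst (λ k → k ≤ q ^ m * 1) (sym (cong (λ k → (k + 0) * 1) (𝟙-true (small? {t} {n} m []) ([] , z≤n))))
    (*-monoˡ-≤ 1 (m^n>0 q {{m^n≢0 b 9}} m))
  count≤ (suc s) {v₀ ∷ X₀} m (s≤s len) uniq@(_ ∷ uniq₀) = by-scale (scale (suc y)) refl m
    where
    open ≤-Reasoning
    y = length X₀
    Bound : ℕ → Set
    Bound m = count (v₀ ∷ X₀) m * den (suc y) ≤ q ^ m * num (suc y)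
    via : ∀ v X′ c₂ m → v₀ ∷ X₀ ↭ v ∷ X′ → count (v ∷ X′) m ≤ count X′ m + c₂ →
          c₂ * den y * rate (suc y) ≤ q ^ m * num y → Bound m
    via v X′ c₂ m p c≤ h = ≤-trans (*-monoˡ-≤ (den (suc y)) (≤-trans (≤-reflexive (count-↭ m p)) c≤))
      (combine (count X′ m) c₂ y (q ^ m) (subst (λ k → count X′ m * den k ≤ q ^ m * num k) y′≡y
        (count≤ s m (≤-trans (≤-reflexive y′≡y) len) uniq′)) h)
      where
      y′≡y : length X′ ≡ y
      y′≡y = suc-injective (sym (Perm.↭-length p))
      uniq′ : Unique X′
      uniq′ with _ ∷ u ← unique-↭ p uniq = u
    by-scale : ∀ i → scale (suc y) ≡ i → ∀ m → Bound m
    by-scale _ _ zero = via v₀ X₀ 0 0 P.refl (≤-trans (count-∷-zero v₀ X₀) (m≤m+n _ 0)) z≤n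
    -- At the first scale the rate is q, so the extra factor q paid for choosing v is exactly the
    -- gain required.
    by-scale zero sc (suc m) = via v₀ X₀ (count X₀ m) (suc m) P.refl (count-∷′ v₀ X₀ m) (begin
      count X₀ m * den y * rate (suc y)   ≡⟨ cong (λ k → count X₀ m * den y * b ^ (9 + 3 * k)) sc ⟩
      count X₀ m * den y * q              ≤⟨ *-monoˡ-≤ q (count≤ s m len uniq₀) ⟩
      q ^ m * num y * q                   ≡⟨ shuffle (q ^ m) (num y) q ⟩
      q * q ^ m * num y                   ∎)
      where
      shuffle : ∀ a b c → a * b * c ≡ c * a * b
      shuffle = solve-∀
    -- Beyond it the gain comes from the deleted points through `jump`, with ρ = b^(8 + 2 i) chosen
    -- so that W ρ is `threshold i`.
    by-scale (suc i) sc (suc m)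
      with saturated (b ^ (8 + 2 * i)) uniq (m^n>0 b (8 + 2 * i)) (scale-lower (suc y) sc)
    ... | v , v∈X , ρ²≤ with extract v∈X
    ... | X′ , p = via v X′ (count X″ m) (suc m) p (count-∷ v X′ m)
      (*-cancelʳ-≤ _ _ (den z) {{>-nonZero (den>0 z)}} (begin
        count X″ m * den y * d * den z       ≡⟨ shuffle₁ (count X″ m) (den y) d (den z) ⟩
        count X″ m * den z * (den y * d)     ≤⟨ *-monoˡ-≤ (den y * d) (count≤ s m z≤s uniq″) ⟩
        q ^ m * num z * (den y * d)          ≡⟨ shuffle₂ (q ^ m) (num z) (den y) d ⟩
        q ^ m * (num z * den y * d)          ≤⟨ *-mono-≤ (^-monoʳ-≤ q {{m^n≢0 b 9}} (n≤1+n m)) (jump y z sc z+ρ²≤) ⟩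
        q ^ suc m * (num y * den z)          ≡⟨ *-assoc (q ^ suc m) (num y) (den z) ⟨
        q ^ suc m * num y * den z            ∎))
      where
      X″ = filter (incomparable? v) X′
      z = length X″
      d = rate (suc y)
      y≡ : length X′ ≡ y
      y≡ = suc-injective (sym (Perm.↭-length p))
      z+ρ²≤ : z + b ^ (8 + 2 * i) * b ^ (8 + 2 * i) ≤ suc y
      z+ρ²≤ = ≤-trans (+-monoʳ-≤ z (≤-trans ρ²≤ (≤-reflexive (Perm.↭-length (Perm.filter-↭ (v ≼?_) p)))))
        (≤-trans (filter-incomparable v X′) (≤-reflexive (cong suc y≡)))
      z≤s : z ≤ s
      z≤s = ≤-trans (length-filter (incomparable? v) X′) (≤-trans (≤-reflexive y≡) len)
      uniq″ : Unique X″
      uniq″ with _ ∷ u ← unique-↭ p uniq = UniqueP.filter⁺ (incomparable? v) u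
      shuffle₁ : ∀ a b c d → a * b * c * d ≡ a * d * (b * c)
      shuffle₁ = solve-∀
      shuffle₂ : ∀ a b c d → a * b * (c * d) ≡ a * (b * c * d)
      shuffle₂ = solve-∀

  count^b≤ : ∀ {X : List (Point t n)} m → Unique X → count X m ^ b ≤ q ^ (m * b) * 4 ^ (2 * W)
  count^b≤ {X} m u = *-cancelʳ-≤ _ _ (den x ^ b) {{m^n≢0 (den x) b {{>-nonZero (den>0 x)}}}} (begin
    count X m ^ b * den x ^ b              ≡⟨ ^-distribʳ-* b (count X m) (den x) ⟨
    (count X m * den x) ^ b                ≤⟨ ^-monoˡ-≤ b (count≤ x m ≤-refl u) ⟩
    (q ^ m * num x) ^ b                    ≡⟨ ^-distribʳ-* b (q ^ m) (num x) ⟩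
    (q ^ m) ^ b * num x ^ b                ≤⟨ *-monoʳ-≤ ((q ^ m) ^ b) (num^b≤ x) ⟩
    (q ^ m) ^ b * (den x ^ b * 4 ^ (2 * W)) ≡⟨ shuffle ((q ^ m) ^ b) (den x ^ b) (4 ^ (2 * W)) ⟩
    (q ^ m) ^ b * 4 ^ (2 * W) * den x ^ b  ≡⟨ cong (λ k → k * 4 ^ (2 * W) * den x ^ b) (^-*-assoc q m b) ⟩
    q ^ (m * b) * 4 ^ (2 * W) * den x ^ b  ∎)
    where
    open ≤-Reasoning
    x = length X
    shuffle : ∀ a b c → a * (b * c) ≡ a * c * b
    shuffle = solve-∀

-- Choice of parameters and conclusion

numSmallAntichains≤count : ∀ t n k .{{_ : NonZero k}} → numSmallAntichains t n k ≤ count (allPoints t n) (α t n / k)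
numSmallAntichains≤count t n k = begin
  numSmallAntichains t n k
    ≡⟨ length-filter-∑ (λ A → k * length A ≤? α t n) (antichains t n) ⟩
  ∑ (filter isAntichain? (allSubsets t n)) (λ A → 𝟙 (k * length A ≤? α t n))
    ≡⟨ ∑-filter (allSubsets t n) ⟩
  ∑ (allSubsets t n) (λ A → 𝟙 (isAntichain? A) * 𝟙 (k * length A ≤? α t n))
    ≤⟨ ∑-mono (allSubsets t n) small ⟩
  count (allPoints t n) (α t n / k) ∎
  where
  open ≤-Reasoning
  ∑-filter : ∀ Ω → ∑ (filter isAntichain? Ω) (λ A → 𝟙 (k * length A ≤? α t n)) ≡
                   ∑ Ω (λ A → 𝟙 (isAntichain? A) * 𝟙 (k * length A ≤? α t n))
  ∑-filter [] = refl
  ∑-filter (A ∷ Ω) with isAntichain? A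
  ... | yes _ = cong₂ _+_ (sym (+-identityʳ _)) (∑-filter Ω)
  ... | no _  = ∑-filter Ω
  small : ∀ A → 𝟙 (isAntichain? A) * 𝟙 (k * length A ≤? α t n) ≤ 𝟙 (small? (α t n / k) A)
  small A with isAntichain? A
  ... | no _ = z≤n
  ... | yes anti = ≤-trans (≤-reflexive (+-identityʳ _)) (𝟙-mono (k * length A ≤? α t n) (yes anti ×-dec (length A ≤? α t n / k))
    λ h → anti , ≤-trans (≤-reflexive (sym (m*n/n≡m (length A) k))) (/-monoˡ-≤ k (≤-trans (≤-reflexive (*-comm (length A) k)) h)))

-- With β = k^4 the condition 16 ≤ b is k ≥ 2. After raising to the power β = k · k³, the choices
-- contribute 36 w k³ to the exponent of k, because m k ≤ w, and the product contributes 2 · 2 · 33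
-- w ≤ 132 w k³, because 4 ≤ k²; 168 = 36 + 132.
bound : ∀ t a b k → 2 ≤ k → 1 ≤ α t (a + b) → α t a * t ^ b + α t b * t ^ a ≤ 32 * α t (a + b) →
        numSmallAntichains t (a + b) k ^ k ≤ k ^ (168 * α t (a + b))
bound t a b k 2≤k 1≤w width = ^-cancelʳ-≤ (k ^ 3) {{m^n≢0 k 3}} (begin
  (N ^ k) ^ (k ^ 3)                              ≡⟨ ^-*-assoc N k (k ^ 3) ⟩
  N ^ β                                          ≤⟨ ^-monoˡ-≤ β (numSmallAntichains≤count t (a + b) k) ⟩
  count (allPoints t (a + b)) m ^ β              ≤⟨ count^b≤ m (allPoints-unique t (a + b)) ⟩
  (β ^ 9) ^ (m * β) * 4 ^ (2 * W)                ≤⟨ *-mono-≤ q^≤ 4^≤ ⟩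
  k ^ (36 * w * k ^ 3) * k ^ (132 * w * k ^ 3)   ≡⟨ ^-distribˡ-+-* k (36 * w * k ^ 3) (132 * w * k ^ 3) ⟨
  k ^ (36 * w * k ^ 3 + 132 * w * k ^ 3)         ≡⟨ cong (k ^_) (shuffle w (k ^ 3)) ⟩
  k ^ (168 * w * k ^ 3)                          ≡⟨ ^-*-assoc k (168 * w) (k ^ 3) ⟨
  (k ^ (168 * w)) ^ (k ^ 3)                      ∎)
  where
  open ≤-Reasoning
  instance
    k≢0 : NonZero k
    k≢0 = >-nonZero (≤-trans (s≤s z≤n) 2≤k)
  N w β W m : ℕ
  N = numSmallAntichains t (a + b) k
  w = α t (a + b)
  β = k ^ 4
  -- One more than the 32 of the width bound: w ≥ 1 then gives the strict inequality that
  -- `supersaturation` asks for.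
  W = 33 * w
  m = w / k
  saturated : ∀ ρ {X : List (Point t (a + b))} → Unique X → 1 ≤ ρ → W * ρ ≤ length X →
              ∃ λ v → v ∈ X × ρ * ρ ≤ length (filter (v ≼?_) X)
  saturated ρ u 1≤ρ large = supersaturation-list a b ρ u (begin-strict
    ρ * (α t a * t ^ b + α t b * t ^ a)   ≤⟨ *-monoʳ-≤ ρ width ⟩
    ρ * (32 * w)                          <⟨ *-monoʳ-< ρ {{>-nonZero 1≤ρ}} (m<n+m (32 * w) 1≤w) ⟩
    ρ * (33 * w)                          ≡⟨ *-comm ρ (33 * w) ⟩
    W * ρ                                 ≤⟨ large ⟩
    _                                     ∎)
  open Counting {t} {a + b} β W (^-monoˡ-≤ 4 2≤k) (≤-trans 1≤w (m≤m+n w (32 * w))) saturated using (count^b≤)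
  q^≤ : (β ^ 9) ^ (m * β) ≤ k ^ (36 * w * k ^ 3)
  q^≤ = begin
    (β ^ 9) ^ (m * β)              ≡⟨ cong (_^ (m * β)) (^-*-assoc k 4 9) ⟩
    (k ^ 36) ^ (m * β)             ≡⟨ ^-*-assoc k 36 (m * β) ⟩
    k ^ (36 * (m * (k * k ^ 3)))   ≤⟨ ^-monoʳ-≤ k (begin
      36 * (m * (k * k ^ 3))         ≡⟨ cong (36 *_) (*-assoc m k (k ^ 3)) ⟨
      36 * (m * k * k ^ 3)           ≤⟨ *-monoʳ-≤ 36 (*-monoˡ-≤ (k ^ 3) (m/n*n≤m w k)) ⟩
      36 * (w * k ^ 3)               ≡⟨ *-assoc 36 w (k ^ 3) ⟨
      36 * w * k ^ 3                 ∎) ⟩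
    k ^ (36 * w * k ^ 3)           ∎
  4^≤ : 4 ^ (2 * W) ≤ k ^ (132 * w * k ^ 3)
  4^≤ = begin
    4 ^ (2 * W)                    ≤⟨ ^-monoˡ-≤ (2 * W) (^-monoˡ-≤ 2 2≤k) ⟩
    (k ^ 2) ^ (2 * W)              ≡⟨ ^-*-assoc k 2 (2 * W) ⟩
    k ^ (2 * (2 * (33 * w)))       ≡⟨ cong (k ^_) (shuffle′ w) ⟩
    k ^ (132 * w)                  ≤⟨ ^-monoʳ-≤ k (m≤m*n (132 * w) (k ^ 3) {{m^n≢0 k 3}}) ⟩
    k ^ (132 * w * k ^ 3)          ∎
    where
    shuffle′ : ∀ w → 2 * (2 * (33 * w)) ≡ 132 * w
    shuffle′ = solve-∀
  shuffle : ∀ w p → 36 * w * p + 132 * w * p ≡ 168 * w * p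
  shuffle = solve-∀

α-positive : ∀ t n → 1 ≤ α (suc t) n
α-positive t n = ≤-trans (≤-trans
    (≤-reflexive (sym (𝟙-true (x₀ ≟ᵖ x₀) refl))) (∑-member (λ x → 𝟙 (x ≟ᵖ x₀)) (∈-allPoints x₀)))
  (antichain-size≤α (_≟ᵖ x₀) λ { refl refl _ → refl })
  where
  x₀ : Point (suc t) n
  x₀ = replicate n zero

-- Taking k-th roots, the inequality reads N ≤ 2^(C (log₂ k / k) α); another base of the logarithm
-- only changes C.
theorem2p2 : Σ ℕ (λ C → ∀ (n t k : ℕ) → n ≥ 2 → t ≥ 2 → k ≥ 2 →
    numSmallAntichains t n k ^ k ≤ k ^ (C * α t n))
theorem2p2 = 168 , λ { n (suc t) k n≥2 _ k≥2 → main n t k n≥2 k≥2 }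
  where
  Claim : ℕ → ℕ → ℕ → Set
  Claim t n k = numSmallAntichains (suc t) n k ^ k ≤ k ^ (168 * α (suc t) n)
  halve : ∀ n → ∃ λ a → n ≡ a + a ⊎ n ≡ suc (a + a)
  halve zero = 0 , inj₁ refl
  halve (suc n) with halve n
  ... | a , inj₁ e = a , inj₂ (cong suc e)
  ... | a , inj₂ e = suc a , inj₁ (trans (cong suc e) (cong suc (sym (+-suc a a))))
  main : ∀ n t k → n ≥ 2 → k ≥ 2 → Claim t n k
  main n t k n≥2 k≥2 with halve n
  ... | a , inj₁ refl = bound (suc t) a a k k≥2 (α-positive t (a + a)) (width-even t a)
  -- The odd split with m = 0 is n = 1, excluded by n ≥ 2; `width-odd` is for m ≥ 1.
  main n t k (s≤s ()) k≥2 | zero , inj₂ refl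
  ... | suc a , inj₂ refl = subst (λ n → Claim t n k) (+-suc (suc a) (suc a))
    (bound (suc t) (suc a) (suc (suc a)) k k≥2 (α-positive t (suc a + suc (suc a)))
      (≤-trans (width-odd t a) (≤-reflexive (cong (λ n → 32 * α (suc t) n) (sym (+-suc (suc a) (suc a)))))))
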